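{- For any $R$-round deterministic $\mathsf{AMPC}$ algorithm with I/O capacity $S$ that computes a partial Boolean function $g:\Delta\to\{0,1\}$ with $\Delta\subseteq\{0,1\}^N$, we have $D(g)\le 2S^{6R}$. In particular, $R\ge\frac16\log_S\frac{D(g)}{2}$.
   Context: For a total $f:\{0,1\}^N\to\{0,1\}$, $D(f)$ is its deterministic query (decision tree) complexity: the minimum depth of a deterministic decision tree querying input bits that computes $f$. For a partial $g:\Delta\to\{0,1\}$, $D(g)=\min\{D(f): f:\{0,1\}^N\to\{0,1\},\ f(x)=g(x)\ \forall x\in\Delta\}$. The deterministic $\mathsf{AMPC}$ model with I/O capacity $S$: computation proceeds in rounds using shared key–value stores $\mathcal{D}_0,\mathcal{D}_1,\dots$. $\mathcal{D}_0$ holds the input $x\in\{0,1\}^N$ as the $N$ pairs $(i,x_i)$. In round $r\ge1$, each machine (arbitrarily many, computationally unbounded) adaptively queries keys in $\mathcal{D}_{r-1}$, each response being the multiset of values under that key (empty if none), later queries depending on earlier responses. Per machine per round: total number of values received plus number of empty-response queries is at most $S$, and at most $S$ key–value pairs are written to $\mathcal{D}_r$. In every round, on every input in $\{0,1\}^N$ (including inputs outside $\Delta$), at most $S$ values are written under any single key; on inputs outside $\Delta$ the algorithm runs in the same way, a machine whose query budget would be exceeded stops querying and writes nothing. An algorithm computes $g$ in $R$ rounds if for every $x\in\Delta$, $\mathcal{D}_R$ contains exactly the single pair $(\textsc{answer},g(x))$. -}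

module Defs where

open import Data.Nat using (ℕ; zero; suc; _≤_; _≤?_; _∸_)
open import Data.Nat.Properties using (≤-decTotalOrder)
import Data.Nat as ℕ
open import Data.Bool using (Bool; true; false)
open import Data.Fin using (Fin; toℕ; inject₁; fromℕ)
open import Data.List using (List; []; _∷_; map; filter; length; concatMap; allFin)
open import Data.List.Membership.Propositional using (_∈_)
open import Data.Vec using (Vec; lookup) renaming ([] to []ᵥ; _∷_ to _∷ᵥ_)
open import Data.Maybe using (Maybe; just; nothing)
open import Data.Product using (_×_; _,_; proj₁; proj₂; Σ; ∃)
open import Relation.Binary.PropositionalEquality using (_≡_; _≢_; refl; cong)
open import Relation.Nullary using (Dec; yes; no; ¬_)
open import Data.List.Sort.Base using (SortingAlgorithm)
open import Data.List.Sort.MergeSort ≤-decTotalOrder using (mergeSort)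

data DTree (N : ℕ) : Set where
  leaf : Bool → DTree N
  node : Fin N → DTree N → DTree N → DTree N

depth : ∀ {N} → DTree N → ℕ
depth (leaf _)     = 0
depth (node _ l r) = suc (depth l ℕ.⊔ depth r)

evalDT : ∀ {N} → DTree N → (Fin N → Bool) → Bool
evalDT (leaf b)     x = b
evalDT (node i l r) x with x i
... | false = evalDT l x
... | true  = evalDT r x

D-total≤ : ∀ {N} → ((Fin N → Bool) → Bool) → ℕ → Set
D-total≤ {N} f d = Σ (DTree N) λ T → depth T ≤ d × (∀ x → evalDT T x ≡ f x)

-- A partial function g : Δ → {0,1}, Δ ⊆ {0,1}^N, is represented as
-- g : {0,1}^N → Maybe Bool with Δ = { x | g x ≢ nothing }.
Partial : ℕ → Set
Partial N = (Fin N → Bool) → Maybe Bool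

-- D(g) ≤ d, unfolding D(g) = min { D(f) : f total, f = g on Δ }.
D≤ : ∀ {N} → Partial N → ℕ → Set
D≤ {N} g d = Σ ((Fin N → Bool) → Bool) λ f →
  (∀ x b → g x ≡ just b → f x ≡ b) × D-total≤ f d

data Key : Set where
  inp    : ℕ → Key
  answer : Key
  aux    : ℕ → Key

Val : Set
Val = ℕ

_≟K_ : (k k′ : Key) → Dec (k ≡ k′)
inp m ≟K inp n with m ℕ.≟ n
... | yes refl = yes refl
... | no  m≢n  = no λ { refl → m≢n refl }
inp _ ≟K answer = no λ ()
inp _ ≟K aux _  = no λ ()
answer ≟K inp _ = no λ ()
answer ≟K answer = yes refl
answer ≟K aux _  = no λ ()
aux _ ≟K inp _  = no λ ()
aux _ ≟K answer = no λ ()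
aux m ≟K aux n with m ℕ.≟ n
... | yes refl = yes refl
... | no  m≢n  = no λ { refl → m≢n refl }

-- A key–value store: a finite multiset of key–value pairs (as a list).
Store : Set
Store = List (Key × Val)

bitVal : Bool → Val
bitVal false = 0
bitVal true  = 1

inputStore : ∀ {N} → (Fin N → Bool) → Store
inputStore {N} x = map (λ i → (inp (toℕ i) , bitVal (x i))) (allFin N)

valuesAt : Key → Store → List Val
valuesAt k D = map proj₂ (filter (λ kv → proj₁ kv ≟K k) D)

sortℕ : List ℕ → List ℕ
sortℕ = SortingAlgorithm.sort mergeSort

-- The response to a query: the multiset of values under the key,
-- represented canonically as a sorted list.
response : Key → Store → List Val
response k D = sortℕ (valuesAt k D)

cost : List Val → ℕ
cost []      = 1
cost (v ∷ vs) = length (v ∷ vs)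

-- A machine program for one round: an adaptive (possibly infinitely
-- branching) query tree whose leaves are the pairs to write.
data Prog : Set where
  write : List (Key × Val) → Prog
  query : Key → (List Val → Prog) → Prog

-- Running a machine with remaining budget b on the previous store D.
-- If a query would exceed the budget the machine stops (nothing),
-- i.e. it writes nothing.
run : ℕ → Store → Prog → Maybe (List (Key × Val))
run b D (write ws)  = just ws
run b D (query k c) with cost (response k D) ≤? b
... | yes _ = run (b ∸ cost (response k D)) D (c (response k D))
... | no  _ = nothing

writesOf : Maybe (List (Key × Val)) → List (Key × Val)
writesOf (just ws) = ws
writesOf nothing   = []

step : ℕ → Store → List Prog → Store
step S D ms = concatMap (λ p → writesOf (run S D p)) ms

Algorithm : ℕ → Set
Algorithm R = Vec (List Prog) R

trace : ∀ {R} → ℕ → Algorithm R → Store → Vec Store (suc R)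
trace S []ᵥ       D = D ∷ᵥ []ᵥ
trace S (ms ∷ᵥ A) D = D ∷ᵥ trace S A (step S D ms)

storeAt : ∀ {N R} → ℕ → Algorithm R → (Fin N → Bool) → Fin (suc R) → Store
storeAt S A x r = lookup (trace S A (inputStore x)) r

record Computes {N R : ℕ} (S : ℕ) (A : Algorithm R) (g : Partial N) : Set where
  field
    query-budget : ∀ x → g x ≢ nothing → ∀ (r : Fin R) p → p ∈ lookup A r →
                   run S (storeAt {N} S A x (inject₁ r)) p ≢ nothing
    write-budget : ∀ (x : Fin N → Bool) (r : Fin R) p → p ∈ lookup A r → ∀ ws →
                   run S (storeAt {N} S A x (inject₁ r)) p ≡ just ws → length ws ≤ S
    key-capacity : ∀ (x : Fin N → Bool) (r : Fin R) k →
                   length (valuesAt k (storeAt S A x (Data.Fin.suc r))) ≤ S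
    correct      : ∀ x b → g x ≡ just b →
                   storeAt S A x (fromℕ R) ≡ (answer , bitVal b) ∷ []

{-# OPTIONS --safe #-}
module Submission where

-- Let q(x) be the number of pairs (answer , 1) in the last store; on Δ it equals g, and
-- 0 ≤ q ≤ S everywhere. One round multiplies the degree of "the response under k is ρ" by
-- at most S²: a run is a product of at most S responses, and since on every input at most S
-- values lie under a key, in the inclusion–exclusion over the machines writing to that key
-- the products of more than S factors vanish. The last round only costs a factor S, because q
-- is a sum over machines; hence q has degree at most e = S^(2R-1).
--
-- The decision tree repeatedly queries all variables of a monomial of maximal degree of the
-- current restriction of q. Its coefficient survives every further restriction, so each
-- queried monomial contains a block on which the final input is sensitive. To bound the number
-- of blocks, set each of them independently to its sensitive value with probability t²/e²: the
-- expectation of q is an even polynomial in t of degree at most 2e, it stays in [0 , S] at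
-- t = 0 , … , e, and its t²-coefficient is the sum of the jumps divided by e². The 2e-th central
-- difference annihilates its quotient by t² (after subtracting the value at 0), which bounds that
-- coefficient by S · 2∑1/j² ≤ 4S. Up-jumps and down-jumps
-- together give at most 8Se² blocks, hence depth at most 8Se³ ≤ 2S^(6R) when S ≥ 2. For S = 1
-- the degree is 1 and the constant 4 can be replaced by 1.

open import Defs

-- Integer polynomials, central differences and a Markov-type inequality.

module EvenPolynomials where

  open import Data.Nat as ℕ using (ℕ; zero; suc)
  import Data.Nat.Properties as ℕₚ
  import Data.Nat.Tactic.RingSolver as ℕ-Solver
  open import Data.Integer hiding (suc; NonZero)
  open import Data.Integer.Properties
  open import Data.Integer.Tactic.RingSolver using (solve-∀)
  open import Relation.Binary.PropositionalEquality

  Δ : (ℤ → ℤ) → ℤ → ℤ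
  Δ P t = P (1ℤ + t) - P t

  -- Degree below `n`, encoded by the vanishing of the `n`-th forward difference, so that no
  -- coefficients or rationals appear.
  data PolLt : ℕ → (ℤ → ℤ) → Set where
    vanishes   : ∀ {n P} → (∀ t → P t ≡ 0ℤ) → PolLt n P
    difference : ∀ {n P} → PolLt n (Δ P) → PolLt (suc n) P

  PolLt-zero : ∀ {P} → PolLt 0 P → ∀ t → P t ≡ 0ℤ
  PolLt-zero (vanishes z) = z

  private
    Δ-+ : ∀ a b c d → (a - b) + (c - d) ≡ (a + c) - (b + d)
    Δ-+ = solve-∀

    Δ-* : ∀ c a b → c * (a - b) ≡ c * a - c * b
    Δ-* = solve-∀

    Δ-t* : ∀ t a b → (1ℤ + t) * a - t * b ≡ t * (a - b) + a
    Δ-t* t a b = trans (cong (_- t * b) (trans (*-distribʳ-+ a 1ℤ t) (cong (_+ t * a) (*-identityˡ a)))) (rearrange a t b)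
      where
      rearrange : ∀ a t b → (a + t * a) - t * b ≡ t * (a - b) + a
      rearrange = solve-∀

  PolLt-cong : ∀ {n P Q} → (∀ t → P t ≡ Q t) → PolLt n P → PolLt n Q
  PolLt-cong eq (vanishes z)   = vanishes λ t → trans (sym (eq t)) (z t)
  PolLt-cong eq (difference p) = difference (PolLt-cong (λ t → cong₂ _-_ (eq (1ℤ + t)) (eq t)) p)

  PolLt-Δ : ∀ {n P} → PolLt (suc n) P → PolLt n (Δ P)
  PolLt-Δ (vanishes z)   = vanishes λ t → cong₂ _-_ (z (1ℤ + t)) (z t)
  PolLt-Δ (difference p) = p

  PolLt-const : ∀ {n} c → PolLt (suc n) (λ _ → c)
  PolLt-const c = difference (vanishes λ _ → +-inverseʳ c)

  PolLt-+ : ∀ {n P Q} → PolLt n P → PolLt n Q → PolLt n (λ t → P t + Q t)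
  PolLt-+ (vanishes z) q = PolLt-cong (λ t → trans (sym (+-identityˡ _)) (cong (_+ _) (sym (z t)))) q
  PolLt-+ {P = P} (difference p) (vanishes z) =
    PolLt-cong (λ t → trans (sym (+-identityʳ (P t))) (cong (λ u → P t + u) (sym (z t)))) (difference {P = P} p)
  PolLt-+ {P = P} {Q} (difference p) (difference q) =
    difference (PolLt-cong (λ t → Δ-+ (P (1ℤ + t)) (P t) (Q (1ℤ + t)) (Q t)) (PolLt-+ p q))

  PolLt-scale : ∀ {n P} c → PolLt n P → PolLt n (λ t → c * P t)
  PolLt-scale c (vanishes z) = vanishes λ t → trans (cong (c *_) (z t)) (*-zeroʳ c)
  PolLt-scale {P = P} c (difference p) = difference (PolLt-cong (λ t → Δ-* c (P (1ℤ + t)) (P t)) (PolLt-scale c p))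

  PolLt-shift : ∀ {n P} c → PolLt n P → PolLt n (λ t → P (c + t))
  PolLt-shift c (vanishes z) = vanishes λ t → z (c + t)
  PolLt-shift {P = P} c (difference p) =
    difference (PolLt-cong (λ t → cong (λ u → P u - P (c + t)) (swap c t)) (PolLt-shift c p))
    where
    swap : ∀ c t → 1ℤ + (c + t) ≡ c + (1ℤ + t)
    swap c t = trans (sym (+-assoc 1ℤ c t)) (trans (cong (_+ t) (+-comm 1ℤ c)) (+-assoc c 1ℤ t))

  -- The product rule `Δ (t P) = t ΔP + P (1 + t)` drives the induction.
  PolLt-t* : ∀ {n P} → PolLt n P → PolLt (suc n) (λ t → t * P t)
  PolLt-t* (vanishes z) = vanishes λ t → trans (cong (t *_) (z t)) (*-zeroʳ t)
  PolLt-t* {P = P} (difference p) = difference (PolLt-cong (λ t → sym (Δ-t* t (P (1ℤ + t)) (P t)))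
    (PolLt-+ (PolLt-t* p) (PolLt-shift {P = P} 1ℤ (difference p))))

  PolLt-t²* : ∀ {n P} → PolLt n P → PolLt (suc (suc n)) (λ t → (t * t) * P t)
  PolLt-t²* {P = P} p = PolLt-cong (λ t → sym (*-assoc t t (P t))) (PolLt-t* (PolLt-t* p))

  Even : (ℤ → ℤ) → Set
  Even P = ∀ t → P (- t) ≡ P t

  -- The negated second central difference.
  δ : (ℤ → ℤ) → ℤ → ℤ
  δ P t = (P t + P t) - (P (1ℤ + t) + P (-1ℤ + t))

  δ-PolLt : ∀ {n P} → PolLt (suc (suc n)) P → PolLt n (δ P)
  δ-PolLt {P = P} p = PolLt-cong eq (PolLt-scale -1ℤ (PolLt-shift -1ℤ (PolLt-Δ (PolLt-Δ p))))
    where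
    up-down : ∀ t → 1ℤ + (-1ℤ + t) ≡ t
    up-down t = trans (sym (+-assoc 1ℤ -1ℤ t)) (+-identityˡ t)
    rearrange : ∀ a b c → - ((a - b) - (b - c)) ≡ (b + b) - (a + c)
    rearrange = solve-∀
    eq : ∀ t → -1ℤ * Δ (Δ P) (-1ℤ + t) ≡ δ P t
    eq t rewrite -1*i≡-i (Δ (Δ P) (-1ℤ + t)) | up-down t = rearrange (P (1ℤ + t)) (P t) (P (-1ℤ + t))

  δ-Even : ∀ {P} → Even P → Even (δ P)
  δ-Even {P} ev t rewrite ev t = cong (λ u → (P t + P t) - u)
    (trans (cong₂ _+_ (trans (cong P (neg-distrib -1ℤ t)) (ev (-1ℤ + t)))
                      (trans (cong P (neg-distrib 1ℤ t)) (ev (1ℤ + t))))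
           (+-comm (P (-1ℤ + t)) (P (1ℤ + t))))
    where
    neg-distrib : ∀ c t → - c + - t ≡ - (c + t)
    neg-distrib c t = sym (neg-distrib-+ c t)

  -- The operator δ on the sequence j ↦ (-1)ʲ P j, for P even: all signs become positive.
  σ : (ℕ → ℤ) → ℕ → ℤ
  σ Q zero    = (Q 0 + Q 0) + (Q 1 + Q 1)
  σ Q (suc j) = Q j + (Q (suc j) + Q (suc j)) + Q (suc (suc j))

  σ^ : ℕ → (ℕ → ℤ) → ℕ → ℤ
  σ^ zero    Q = Q
  σ^ (suc d) Q = σ^ d (σ Q)

  σ-cong : ∀ {Q Q′} → (∀ j → Q j ≡ Q′ j) → ∀ j → σ Q j ≡ σ Q′ j
  σ-cong eq zero    rewrite eq 0 | eq 1 = refl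
  σ-cong eq (suc j) rewrite eq j | eq (suc j) | eq (suc (suc j)) = refl

  σ^-cong : ∀ d {Q Q′} → (∀ j → Q j ≡ Q′ j) → ∀ j → σ^ d Q j ≡ σ^ d Q′ j
  σ^-cong zero    eq = eq
  σ^-cong (suc d) eq = σ^-cong d (σ-cong eq)

  -- The sequence `(-1)^j * P j`; shifting `P` lets an induction on `j` pass to a translate.
  alternate : (ℤ → ℤ) → ℕ → ℤ
  alternate P zero    = P 0ℤ
  alternate P (suc j) = - alternate (λ t → P (1ℤ + t)) j

  alternate-cong : ∀ {P Q : ℤ → ℤ} → (∀ t → P t ≡ Q t) → ∀ j → alternate P j ≡ alternate Q j
  alternate-cong eq zero    = eq 0ℤ
  alternate-cong eq (suc j) = cong -_ (alternate-cong (λ t → eq (1ℤ + t)) j)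

  private
    shift-shift : ∀ (P : ℤ → ℤ) t → δ (λ u → P (1ℤ + u)) t ≡ δ P (1ℤ + t)
    shift-shift P t = cong (λ u → (P (1ℤ + t) + P (1ℤ + t)) - (P (1ℤ + (1ℤ + t)) + P u))
      (trans (sym (+-assoc 1ℤ -1ℤ t)) (+-assoc -1ℤ 1ℤ t))

  σ-alternate-suc : ∀ P j → σ (alternate P) (suc j) ≡ alternate (δ P) (suc j)
  σ-alternate-suc P zero    = rearrange (P 0ℤ) (P 1ℤ) (P (1ℤ + 1ℤ))
    where
    rearrange : ∀ a b c → a + (- b + - b) + - - c ≡ - ((b + b) - (c + a))
    rearrange = solve-∀
  σ-alternate-suc P (suc j) = trans
    (rearrange (alternate P₁ j) (alternate P₁ (suc j)) (alternate P₁ (suc (suc j))))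
    (cong -_ (trans (σ-alternate-suc P₁ j) (alternate-cong (shift-shift P) (suc j))))
    where
    P₁ : ℤ → ℤ
    P₁ t = P (1ℤ + t)
    rearrange : ∀ a b c → - a + (- b + - b) + - c ≡ - (a + (b + b) + c)
    rearrange = solve-∀

  -- At index 0 the left neighbour lies outside the sequence, and evenness replaces `P -1` by `P 1`.
  σ-alternate : ∀ P → Even P → ∀ j → σ (alternate P) j ≡ alternate (δ P) j
  σ-alternate P ev zero rewrite ev 1ℤ = rearrange (P 0ℤ) (P 1ℤ)
    where
    rearrange : ∀ a b → (a + a) + (- b + - b) ≡ (a + a) - (b + b)
    rearrange = solve-∀
  σ-alternate P ev (suc j) = σ-alternate-suc P j

  ∣alternate∣ : ∀ P j → ∣ alternate P j ∣ ≡ ∣ P (+ j) ∣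
  ∣alternate∣ P zero    = refl
  ∣alternate∣ P (suc j) = trans (∣-i∣≡∣i∣ (alternate (λ t → P (1ℤ + t)) j)) (∣alternate∣ (λ t → P (1ℤ + t)) j)

  -- Each `σ` acts as `δ`, which keeps evenness and lowers the degree by two.
  σ^-vanishes : ∀ d P → Even P → PolLt (d ℕ.+ d) P → σ^ d (alternate P) 0 ≡ 0ℤ
  σ^-vanishes zero    P ev p = PolLt-zero p 0ℤ
  σ^-vanishes (suc d) P ev p = trans (σ^-cong d (σ-alternate P ev) 0)
    (σ^-vanishes d (δ P) (δ-Even ev) (δ-PolLt (subst (λ n → PolLt n P) (cong suc (ℕₚ.+-suc d d)) p)))

  -- The inner product over `-n , … , n` of two even sequences, folded onto the nonnegative indices;
  -- hence every index except 0 counts twice.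
  pairing : ℕ → (ℕ → ℤ) → (ℕ → ℤ) → ℤ
  pairing zero    w Q = w 0 * Q 0
  pairing (suc n) w Q = pairing n w Q + (w (suc n) * Q (suc n) + w (suc n) * Q (suc n))

  -- Summation by parts: σ is self-adjoint up to a boundary term.
  σ-adjoint : ∀ n w Q → pairing n (σ w) Q ≡
    pairing n w (σ Q) + ((w (suc n) * Q n + w (suc n) * Q n) - (w n * Q (suc n) + w n * Q (suc n)))
  σ-adjoint zero w Q = base (w 0) (w 1) (Q 0) (Q 1)
    where
    base : ∀ w₀ w₁ q₀ q₁ → ((w₀ + w₀) + (w₁ + w₁)) * q₀ ≡
      w₀ * ((q₀ + q₀) + (q₁ + q₁)) + ((w₁ * q₀ + w₁ * q₀) - (w₀ * q₁ + w₀ * q₁))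
    base = solve-∀
  σ-adjoint (suc n) w Q = trans (cong (_+ (σ w (suc n) * Q (suc n) + σ w (suc n) * Q (suc n))) (σ-adjoint n w Q))
    (next (pairing n w (σ Q)) (w n) (w (suc n)) (w (suc (suc n))) (Q n) (Q (suc n)) (Q (suc (suc n))))
    where
    next : ∀ s w₀ w₁ w₂ q₀ q₁ q₂ →
      (s + ((w₁ * q₀ + w₁ * q₀) - (w₀ * q₁ + w₀ * q₁))) + ((w₀ + (w₁ + w₁) + w₂) * q₁ + (w₀ + (w₁ + w₁) + w₂) * q₁) ≡
      (s + (w₁ * (q₀ + (q₁ + q₁) + q₂) + w₁ * (q₀ + (q₁ + q₁) + q₂))) + ((w₂ * q₁ + w₂ * q₁) - (w₁ * q₂ + w₁ * q₂))
    next = solve-∀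

  -- weight d j = binomial (2d) (d + j).
  weight : ℕ → ℕ → ℤ
  weight zero    zero    = 1ℤ
  weight zero    (suc j) = 0ℤ
  weight (suc d) = σ (weight d)

  weight-support : ∀ d j → d ℕ.< j → weight d j ≡ 0ℤ
  weight-support zero    (suc j) _ = refl
  weight-support (suc d) (suc j) (ℕ.s≤s d<j)
    rewrite weight-support d j d<j
          | weight-support d (suc j) (ℕₚ.m<n⇒m<1+n d<j)
          | weight-support d (suc (suc j)) (ℕₚ.m<n⇒m<1+n (ℕₚ.m<n⇒m<1+n d<j)) = refl

  weight-nonneg : ∀ d j → 0ℤ ≤ weight d j
  weight-nonneg zero    zero    = +≤+ ℕ.z≤n
  weight-nonneg zero    (suc j) = +≤+ ℕ.z≤n
  weight-nonneg (suc d) zero    =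
    +-mono-≤ (+-mono-≤ (weight-nonneg d 0) (weight-nonneg d 0)) (+-mono-≤ (weight-nonneg d 1) (weight-nonneg d 1))
  weight-nonneg (suc d) (suc j) =
    +-mono-≤ (+-mono-≤ (weight-nonneg d j) (+-mono-≤ (weight-nonneg d (suc j)) (weight-nonneg d (suc j))))
             (weight-nonneg d (suc (suc j)))

  -- Monotonicity passes through `σ` term by term. At the centre it reduces to comparing the weights
  -- at 2 and 0.
  weight-decreasing : ∀ d j → weight d (suc j) ≤ weight d j
  weight-decreasing zero    zero    = +≤+ ℕ.z≤n
  weight-decreasing zero    (suc j) = +≤+ ℕ.z≤n
  weight-decreasing (suc d) zero    = ≤-trans
    (+-monoʳ-≤ (weight d 0 + (weight d 1 + weight d 1)) (≤-trans (weight-decreasing d 1) (weight-decreasing d 0)))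
    (≤-reflexive (rearrange (weight d 0) (weight d 1)))
    where
    rearrange : ∀ a b → (a + (b + b)) + a ≡ (a + a) + (b + b)
    rearrange = solve-∀
  weight-decreasing (suc d) (suc j) = +-mono-≤
    (+-mono-≤ (weight-decreasing d j) (+-mono-≤ (weight-decreasing d (suc j)) (weight-decreasing d (suc j))))
    (weight-decreasing d (suc (suc j)))

  weight-≤-centre : ∀ d j → weight d j ≤ weight d 0
  weight-≤-centre d zero    = ≤-refl
  weight-≤-centre d (suc j) = ≤-trans (weight-decreasing d j) (weight-≤-centre d j)

  weight-centre-pos : ∀ d → 1ℤ ≤ weight d 0
  weight-centre-pos zero    = ≤-refl
  weight-centre-pos (suc d) = +-mono-≤ (+-mono-≤ (weight-centre-pos d) (weight-nonneg d 0))
    (+-mono-≤ (weight-nonneg d 1) (weight-nonneg d 1))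

  pairing-unit : ∀ n Q → pairing n (weight 0) Q ≡ Q 0
  pairing-unit zero    Q = *-identityˡ (Q 0)
  pairing-unit (suc n) Q = trans (+-identityʳ _) (pairing-unit n Q)

  -- Self-adjointness moves all `d` copies of `σ` from the unit weight onto `Q`; the boundary terms
  -- lie outside the support of the weights.
  pairing-weight : ∀ n d → d ℕ.≤ n → ∀ Q → pairing n (weight d) Q ≡ σ^ d Q 0
  pairing-weight n zero    _   Q = pairing-unit n Q
  pairing-weight n (suc d) d<n Q = begin
    pairing n (σ (weight d)) Q
      ≡⟨ σ-adjoint n (weight d) Q ⟩
    pairing n (weight d) (σ Q) + _
      ≡⟨ cong (λ u → pairing n (weight d) (σ Q) + u) boundary ⟩
    pairing n (weight d) (σ Q) + 0ℤ
      ≡⟨ +-identityʳ _ ⟩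
    pairing n (weight d) (σ Q)
      ≡⟨ pairing-weight n d (ℕₚ.<⇒≤ d<n) (σ Q) ⟩
    σ^ d (σ Q) 0 ∎
    where
    open ≡-Reasoning
    boundary : (weight d (suc n) * Q n + weight d (suc n) * Q n) - (weight d n * Q (suc n) + weight d n * Q (suc n)) ≡ 0ℤ
    boundary rewrite weight-support d n d<n | weight-support d (suc n) (ℕₚ.m<n⇒m<1+n d<n) = refl

  -- Bounding the central value by the others.

  absSum : ℕ → (ℕ → ℤ) → ℕ
  absSum zero    Q = 0
  absSum (suc n) Q = absSum n Q ℕ.+ ∣ Q (suc n) ∣

  ∣∣-mono : ∀ {i j} → 0ℤ ≤ i → i ≤ j → ∣ i ∣ ℕ.≤ ∣ j ∣
  ∣∣-mono {+ m} {+ n} _ (+≤+ m≤n) = m≤n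

  -- Every off-centre weight is at most the central one, and each index occurs on both sides.
  pairing-tail : ∀ n d Q → ∣ pairing n (weight d) Q - weight d 0 * Q 0 ∣ ℕ.≤ ∣ weight d 0 ∣ ℕ.* (absSum n Q ℕ.+ absSum n Q)
  pairing-tail zero    d Q rewrite +-inverseʳ (weight d 0 * Q 0) = ℕ.z≤n
  pairing-tail (suc n) d Q = begin
    ∣ (s + (u + u)) - c ∣
      ≡⟨ cong ∣_∣ (rearrange s u c) ⟩
    ∣ (s - c) + (u + u) ∣
      ≤⟨ ∣i+j∣≤∣i∣+∣j∣ (s - c) (u + u) ⟩
    ∣ s - c ∣ ℕ.+ ∣ u + u ∣
      ≤⟨ ℕₚ.+-mono-≤ (pairing-tail n d Q) (ℕₚ.≤-trans (∣i+j∣≤∣i∣+∣j∣ u u) (ℕₚ.+-mono-≤ ∣u∣≤ ∣u∣≤)) ⟩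
    W ℕ.* (a ℕ.+ a) ℕ.+ (W ℕ.* q ℕ.+ W ℕ.* q)
      ≡⟨ collect W a q ⟩
    W ℕ.* ((a ℕ.+ q) ℕ.+ (a ℕ.+ q)) ∎
    where
    open ℕₚ.≤-Reasoning
    s u c : ℤ
    s = pairing n (weight d) Q
    u = weight d (suc n) * Q (suc n)
    c = weight d 0 * Q 0
    W a q : ℕ
    W = ∣ weight d 0 ∣
    a = absSum n Q
    q = ∣ Q (suc n) ∣
    rearrange : ∀ s u c → (s + (u + u)) - c ≡ (s - c) + (u + u)
    rearrange = solve-∀
    collect : ∀ W a q → W ℕ.* (a ℕ.+ a) ℕ.+ (W ℕ.* q ℕ.+ W ℕ.* q) ≡ W ℕ.* ((a ℕ.+ q) ℕ.+ (a ℕ.+ q))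
    collect = ℕ-Solver.solve-∀
    ∣u∣≤ : ∣ u ∣ ℕ.≤ W ℕ.* q
    ∣u∣≤ = ℕₚ.≤-trans (ℕₚ.≤-reflexive (∣i*j∣≡∣i∣*∣j∣ (weight d (suc n)) (Q (suc n))))
      (ℕₚ.*-monoˡ-≤ q (∣∣-mono (weight-nonneg d (suc n)) (weight-≤-centre d (suc n))))

  -- The 2d-th difference of an even polynomial of degree below 2d vanishes at 0,
  -- and its largest coefficient is the central one.
  value-at-zero : ∀ d P → Even P → PolLt (d ℕ.+ d) P →
    ∣ P 0ℤ ∣ ℕ.≤ absSum d (alternate P) ℕ.+ absSum d (alternate P)
  value-at-zero d P ev p = ℕₚ.*-cancelˡ-≤ ∣ weight d 0 ∣ {{nz}} (begin
    ∣ weight d 0 ∣ ℕ.* ∣ P 0ℤ ∣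
      ≡⟨ sym (∣i*j∣≡∣i∣*∣j∣ (weight d 0) (P 0ℤ)) ⟩
    ∣ weight d 0 * P 0ℤ ∣
      ≡⟨ sym (∣-i∣≡∣i∣ (weight d 0 * P 0ℤ)) ⟩
    ∣ - (weight d 0 * P 0ℤ) ∣
      ≡⟨ cong ∣_∣ (sym (+-identityˡ (- (weight d 0 * P 0ℤ)))) ⟩
    ∣ 0ℤ - weight d 0 * P 0ℤ ∣
      ≡⟨ cong (λ v → ∣ v - weight d 0 * P 0ℤ ∣) (sym (trans (pairing-weight d d ℕₚ.≤-refl (alternate P)) (σ^-vanishes d P ev p))) ⟩
    ∣ pairing d (weight d) (alternate P) - weight d 0 * P 0ℤ ∣
      ≤⟨ pairing-tail d d (alternate P) ⟩
    ∣ weight d 0 ∣ ℕ.* (absSum d (alternate P) ℕ.+ absSum d (alternate P)) ∎)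
    where
    open ℕₚ.≤-Reasoning
    nz : ℕ.NonZero ∣ weight d 0 ∣
    nz = ℕ.>-nonZero (∣∣-mono (+≤+ ℕ.z≤n) (weight-centre-pos d))

  -- The invariant is ∑_{j ≤ D} 1/j² ≤ 2 - 1/D.
  absSum-inverse-squares : ∀ W e Q → (∀ j → j ℕ.≤ suc e → j ℕ.* j ℕ.* ∣ Q j ∣ ℕ.≤ W) →
    suc e ℕ.* absSum (suc e) Q ℕ.+ W ℕ.≤ suc e ℕ.* (W ℕ.+ W)
  absSum-inverse-squares W zero    Q bound = begin
    1 ℕ.* ∣ Q 1 ∣ ℕ.+ W ≤⟨ ℕₚ.+-monoˡ-≤ W (bound 1 ℕₚ.≤-refl) ⟩
    W ℕ.+ W             ≡⟨ sym (ℕₚ.*-identityˡ (W ℕ.+ W)) ⟩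
    1 ℕ.* (W ℕ.+ W)     ∎
    where open ℕₚ.≤-Reasoning
  absSum-inverse-squares W (suc e) Q bound = ℕₚ.*-cancelˡ-≤ D (begin
    D ℕ.* (suc D ℕ.* (s ℕ.+ r) ℕ.+ W)
      ≡⟨ expand D (suc D) s r W ⟩
    suc D ℕ.* (D ℕ.* s) ℕ.+ (D ℕ.* suc D ℕ.* r ℕ.+ D ℕ.* W)
      ≤⟨ ℕₚ.+-monoʳ-≤ (suc D ℕ.* (D ℕ.* s)) (ℕₚ.+-monoˡ-≤ (D ℕ.* W) r-small) ⟩
    suc D ℕ.* (D ℕ.* s) ℕ.+ suc D ℕ.* W
      ≡⟨ sym (ℕₚ.*-distribˡ-+ (suc D) (D ℕ.* s) W) ⟩
    suc D ℕ.* (D ℕ.* s ℕ.+ W)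
      ≤⟨ ℕₚ.*-monoʳ-≤ (suc D) (absSum-inverse-squares W e Q (λ j j≤D → bound j (ℕₚ.m≤n⇒m≤1+n j≤D))) ⟩
    suc D ℕ.* (D ℕ.* (W ℕ.+ W))
      ≡⟨ swap (suc D) D (W ℕ.+ W) ⟩
    D ℕ.* (suc D ℕ.* (W ℕ.+ W)) ∎)
    where
    open ℕₚ.≤-Reasoning
    D s r : ℕ
    D = suc e
    s = absSum D Q
    r = ∣ Q (suc D) ∣
    -- This is 1/(D+1)² ≤ 1/D - 1/(D+1) with denominators cleared, so the invariant telescopes.
    r-small : D ℕ.* suc D ℕ.* r ℕ.≤ W
    r-small = ℕₚ.≤-trans (ℕₚ.*-monoˡ-≤ r (ℕₚ.*-monoˡ-≤ (suc D) (ℕₚ.n≤1+n D))) (bound (suc D) ℕₚ.≤-refl)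
    expand : ∀ D D′ s r W → D ℕ.* (D′ ℕ.* (s ℕ.+ r) ℕ.+ W) ≡ D′ ℕ.* (D ℕ.* s) ℕ.+ (D ℕ.* D′ ℕ.* r ℕ.+ D ℕ.* W)
    expand = ℕ-Solver.solve-∀
    swap : ∀ a b c → a ℕ.* (b ℕ.* c) ≡ b ℕ.* (a ℕ.* c)
    swap = ℕ-Solver.solve-∀

  absSum≤2W : ∀ W d Q → (∀ j → j ℕ.≤ d → j ℕ.* j ℕ.* ∣ Q j ∣ ℕ.≤ W) → absSum d Q ℕ.≤ W ℕ.+ W
  absSum≤2W W zero    Q bound = ℕ.z≤n
  absSum≤2W W (suc e) Q bound = ℕₚ.*-cancelˡ-≤ (suc e)
    (ℕₚ.≤-trans (ℕₚ.m≤m+n _ W) (absSum-inverse-squares W e Q bound))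

  -- A Markov-type inequality: the nodes j² play the role of the Chebyshev nodes.
  markov : ∀ W d P → Even P → PolLt (d ℕ.+ d) P →
    (∀ j → j ℕ.≤ d → j ℕ.* j ℕ.* ∣ P (+ j) ∣ ℕ.≤ W) → ∣ P 0ℤ ∣ ℕ.≤ 4 ℕ.* W
  markov W d P ev p bound = begin
    ∣ P 0ℤ ∣                  ≤⟨ value-at-zero d P ev p ⟩
    s ℕ.+ s                   ≤⟨ ℕₚ.+-mono-≤ s≤ s≤ ⟩
    (W ℕ.+ W) ℕ.+ (W ℕ.+ W)   ≡⟨ four W ⟩
    4 ℕ.* W                   ∎
    where
    open ℕₚ.≤-Reasoning
    s : ℕ
    s = absSum d (alternate P)
    s≤ : s ℕ.≤ W ℕ.+ W
    s≤ = absSum≤2W W d (alternate P) λ j j≤d →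
      subst (λ v → j ℕ.* j ℕ.* v ℕ.≤ W) (sym (∣alternate∣ P j)) (bound j j≤d)
    four : ∀ W → (W ℕ.+ W) ℕ.+ (W ℕ.+ W) ≡ 4 ℕ.* W
    four = ℕ-Solver.solve-∀

  -- Here `δ P` vanishes at 0, so `2 P 0 = P 1 + P -1 = 2 P 1`. This supplies the constant 1 for
  -- `S = 1`.
  markov-linear : ∀ W P → Even P → PolLt 2 P → ∣ P 1ℤ ∣ ℕ.≤ W → ∣ P 0ℤ ∣ ℕ.≤ W
  markov-linear W P ev p bound = subst (λ v → ∣ v ∣ ℕ.≤ W) (sym P0≡P1) bound
    where
    halve : ∀ a b → (a + a) - (b + b) ≡ 0ℤ → a ≡ b
    halve a b eq = *-cancelˡ-≡ (+ 2) a b (trans (twice a) (trans (i-j≡0⇒i≡j (a + a) (b + b) eq) (sym (twice b))))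
      where
      twice : ∀ a → + 2 * a ≡ a + a
      twice = solve-∀
    P0≡P1 : P 0ℤ ≡ P 1ℤ
    P0≡P1 = halve (P 0ℤ) (P 1ℤ)
      (subst (λ v → (P 0ℤ + P 0ℤ) - (P 1ℤ + v) ≡ 0ℤ) (ev 1ℤ) (PolLt-zero (δ-PolLt p) 0ℤ))

-- Degree of functions on the Boolean cube.

module BooleanCube where

  open import Data.Nat as ℕ using (ℕ; zero; suc)
  import Data.Nat.Properties as ℕₚ
  open import Data.Bool using (Bool; true; false)
  open import Data.Fin using (Fin; zero; suc)
  import Data.Fin.Properties as Finₚ
  open import Data.Integer hiding (suc; NonZero)
  open import Data.Integer.Properties
  open import Data.Integer.Tactic.RingSolver using (solve-∀)
  open import Data.Product using (Σ; ∃; _×_; _,_)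
  open import Data.Sum using (_⊎_; inj₁; inj₂)
  open import Data.Vec using (Vec; []; _∷_; lookup; _[_]≔_; tabulate)
  open import Data.Vec.Properties using ([]≔-idempotent; []≔-commutes; []≔-lookup; lookup∘tabulate; lookup∘updateAt; lookup∘updateAt′)
  open import Function using (_∘_)
  open import Relation.Binary.PropositionalEquality
  open import Relation.Nullary using (¬_; yes; no; contradiction)

  Cube : ℕ → Set
  Cube N = Vec Bool N

  ∂ : ∀ {N} → Fin N → (Cube N → ℤ) → Cube N → ℤ
  ∂ i f x = f (x [ i ]≔ true) - f (x [ i ]≔ false)

  -- DegLt n f: the multilinear polynomial representing f has degree below n.
  data DegLt {N} : ℕ → (Cube N → ℤ) → Set where
    vanishes : ∀ {n f} → (∀ x → f x ≡ 0ℤ) → DegLt n f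
    derive   : ∀ {n f} → (∀ i → DegLt n (∂ i f)) → DegLt (suc n) f

  DegLt-zero : ∀ {N} {f : Cube N → ℤ} → DegLt 0 f → ∀ x → f x ≡ 0ℤ
  DegLt-zero (vanishes z) = z

  DegLt-cong : ∀ {N n} {f g : Cube N → ℤ} → (∀ x → f x ≡ g x) → DegLt n f → DegLt n g
  DegLt-cong eq (vanishes z) = vanishes λ x → trans (sym (eq x)) (z x)
  DegLt-cong eq (derive d)   = derive λ i → DegLt-cong (λ x → cong₂ _-_ (eq _) (eq _)) (d i)

  DegLt-∂ : ∀ {N n} {f : Cube N → ℤ} → DegLt (suc n) f → ∀ i → DegLt n (∂ i f)
  DegLt-∂ (vanishes z) i = vanishes λ x → cong₂ _-_ (z _) (z _)
  DegLt-∂ (derive d)   i = d i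

  DegLt-mono : ∀ {N m n} {f : Cube N → ℤ} → m ℕ.≤ n → DegLt m f → DegLt n f
  DegLt-mono m≤n         (vanishes z) = vanishes z
  DegLt-mono (ℕ.s≤s m≤n) (derive d)   = derive λ i → DegLt-mono m≤n (d i)

  DegLt-≡ : ∀ {N m n} {f : Cube N → ℤ} → m ≡ n → DegLt m f → DegLt n f
  DegLt-≡ refl d = d

  DegLt-const : ∀ {N n} c → DegLt {N} (suc n) (λ _ → c)
  DegLt-const c = derive λ i → vanishes λ _ → +-inverseʳ c

  DegLt-+ : ∀ {N n} {f g : Cube N → ℤ} → DegLt n f → DegLt n g → DegLt n (λ x → f x + g x)
  DegLt-+ {f = f} {g} (vanishes z) d =
    DegLt-cong (λ x → trans (sym (+-identityˡ (g x))) (cong (_+ g x) (sym (z x)))) d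
  DegLt-+ {f = f} {g} (derive d) (vanishes z) =
    DegLt-cong (λ x → trans (sym (+-identityʳ (f x))) (cong (λ u → f x + u) (sym (z x)))) (derive {f = f} d)
  DegLt-+ {f = f} {g} (derive d) (derive d′) = derive λ i →
    DegLt-cong (λ x → rearrange (f (x [ i ]≔ true)) (f (x [ i ]≔ false)) (g (x [ i ]≔ true)) (g (x [ i ]≔ false)))
               (DegLt-+ (d i) (d′ i))
    where
    rearrange : ∀ a b c d → (a - b) + (c - d) ≡ (a + c) - (b + d)
    rearrange = solve-∀

  DegLt-neg : ∀ {N n} {f : Cube N → ℤ} → DegLt n f → DegLt n (λ x → - f x)
  DegLt-neg (vanishes z) = vanishes λ x → cong -_ (z x)
  DegLt-neg {f = f} (derive d) = derive λ i →
    DegLt-cong (λ x → neg-distrib-+ (f (x [ i ]≔ true)) (- f (x [ i ]≔ false))) (DegLt-neg (d i))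

  DegLt-restrict : ∀ {N n} {f : Cube N → ℤ} i v → DegLt n f → DegLt n (λ x → f (x [ i ]≔ v))
  DegLt-restrict i v (vanishes z) = vanishes λ x → z _
  DegLt-restrict {f = f} i v (derive d) = derive λ j → case j
    where
    case : ∀ j → DegLt _ (∂ j (λ x → f (x [ i ]≔ v)))
    case j with i Finₚ.≟ j
    ... | yes refl = vanishes λ x → i≡j⇒i-j≡0
      (cong f (trans ([]≔-idempotent x i) (sym ([]≔-idempotent x i))))
    ... | no  i≢j  = DegLt-cong (λ x → cong₂ _-_ (cong f ([]≔-commutes x i j i≢j)) (cong f ([]≔-commutes x i j i≢j)))
      (DegLt-restrict i v (d j))

  -- Leibniz rule `∂(fg) = ∂f · g₁ + f₀ · ∂g`, where the indices denote restrictions at `i`. The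
  -- bounds are strict, hence the `∸ 1`.
  DegLt-* : ∀ {N} a b {f g : Cube N → ℤ} → DegLt a f → DegLt b g → DegLt (a ℕ.+ b ℕ.∸ 1) (λ x → f x * g x)
  DegLt-* a b {g = g} (vanishes z) _ = vanishes λ x → cong (_* g x) (z x)
  DegLt-* a b {f = f} (derive _) (vanishes z) = vanishes λ x → trans (cong (f x *_) (z x)) (*-zeroʳ (f x))
  DegLt-* (suc a) (suc b) {f} {g} (derive d) (derive d′) =
    DegLt-≡ (sym (ℕₚ.+-suc a b)) (derive λ i →
      DegLt-cong (λ x → leibniz (f (x [ i ]≔ true)) (f (x [ i ]≔ false)) (g (x [ i ]≔ true)) (g (x [ i ]≔ false)))
        (DegLt-+ (DegLt-≡ (cong (ℕ._∸ 1) (ℕₚ.+-suc a b))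
                   (DegLt-* a (suc b) (d i) (DegLt-restrict {f = g} i true (derive d′))))
                 (DegLt-* (suc a) b (DegLt-restrict {f = f} i false (derive d)) (d′ i))))
    where
    leibniz : ∀ a b c d → (a - b) * c + b * (c - d) ≡ a * c - b * d
    leibniz = solve-∀

  Deg : ∀ {N} → ℕ → (Cube N → ℤ) → Set
  Deg d = DegLt (suc d)

  Deg-* : ∀ {N a b} {f g : Cube N → ℤ} → Deg a f → Deg b g → Deg (a ℕ.+ b) (λ x → f x * g x)
  Deg-* {a = a} {b} d d′ = DegLt-≡ (ℕₚ.+-suc a b) (DegLt-* (suc a) (suc b) d d′)

  Deg-coordinate : ∀ {N} (φ : Bool → ℤ) (i : Fin N) → Deg 1 (λ x → φ (lookup x i))
  Deg-coordinate φ i = derive case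
    where
    case : ∀ j → DegLt 1 (∂ j (λ x → φ (lookup x i)))
    case j with i Finₚ.≟ j
    ... | yes refl = DegLt-cong (λ x → sym (cong₂ (λ u v → φ u - φ v) (lookup∘updateAt i x) (lookup∘updateAt i x)))
      (DegLt-const (φ true - φ false))
    ... | no  i≢j  = vanishes λ x → i≡j⇒i-j≡0
      (cong φ (trans (lookup∘updateAt′ i j i≢j x) (sym (lookup∘updateAt′ i j i≢j x))))

  Deg-zero-constant : ∀ {N} {f : Cube N → ℤ} → Deg 0 f → ∀ x y → f x ≡ f y
  Deg-zero-constant d = constant λ i x → i-j≡0⇒i≡j _ _ (DegLt-zero (DegLt-∂ d i) x)
    where
    constant : ∀ {N} {f : Cube N → ℤ} → (∀ i x → f (x [ i ]≔ true) ≡ f (x [ i ]≔ false)) → ∀ x y → f x ≡ f y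
    constant eq [] [] = refl
    constant {f = f} eq (a ∷ x) (b ∷ y) = trans (head a) (trans
      (constant {f = λ z → f (false ∷ z)} (λ i z → eq (suc i) (false ∷ z)) x y) (sym (head b)))
      where
      head : ∀ a {z} → f (a ∷ z) ≡ f (false ∷ z)
      head false     = refl
      head true  {z} = eq zero (false ∷ z)

  -- Maximal monomials and sensitive blocks.

  search-Fin : ∀ {n} {A B : Fin n → Set} → (∀ i → A i ⊎ B i) → (∀ i → A i) ⊎ ∃ B
  search-Fin {zero}  c = inj₁ λ ()
  search-Fin {suc n} c with c zero | search-Fin (λ i → c (suc i))
  ... | inj₂ b | _             = inj₂ (zero , b)
  ... | inj₁ _ | inj₂ (i , b)  = inj₂ (suc i , b)
  ... | inj₁ a | inj₁ as       = inj₁ λ { zero → a ; (suc i) → as i }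

  search-Cube : ∀ {n} {A B : Cube n → Set} → (∀ x → A x ⊎ B x) → (∀ x → A x) ⊎ ∃ B
  search-Cube {zero} c with c []
  ... | inj₁ a = inj₁ λ { [] → a }
  ... | inj₂ b = inj₂ ([] , b)
  search-Cube {suc n} c with search-Cube (λ x → c (false ∷ x)) | search-Cube (λ x → c (true ∷ x))
  ... | inj₂ (x , b) | _            = inj₂ (false ∷ x , b)
  ... | inj₁ _       | inj₂ (x , b) = inj₂ (true ∷ x , b)
  ... | inj₁ as      | inj₁ as′     = inj₁ λ { (false ∷ x) → as x ; (true ∷ x) → as′ x }

  -- For a monomial of maximal degree this is its coefficient. A repeated index makes it zero, so a
  -- nonzero value forces distinct variables.
  ∂* : ∀ {N k} → Vec (Fin N) k → (Cube N → ℤ) → Cube N → ℤ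
  ∂* []      f = f
  ∂* (i ∷ M) f = ∂* M (∂ i f)

  DegLt-∂* : ∀ {N k n} {f : Cube N → ℤ} (M : Vec (Fin N) k) → DegLt (k ℕ.+ n) f → DegLt n (∂* M f)
  DegLt-∂* []      d = d
  DegLt-∂* (i ∷ M) d = DegLt-∂* M (DegLt-∂ d i)

  DegLt-decide : ∀ {N} k (f : Cube N → ℤ) →
    DegLt k f ⊎ Σ (Vec (Fin N) k) λ M → ∃ λ x → ∂* M f x ≢ 0ℤ
  DegLt-decide zero f with search-Cube {A = λ x → f x ≡ 0ℤ} {B = λ x → f x ≢ 0ℤ} (λ x → dec (f x))
    where
    dec : ∀ z → z ≡ 0ℤ ⊎ z ≢ 0ℤ
    dec z with z ≟ 0ℤ
    ... | yes p = inj₁ p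
    ... | no ¬p = inj₂ ¬p
  ... | inj₁ z = inj₁ (vanishes z)
  ... | inj₂ w = inj₂ ([] , w)
  DegLt-decide (suc k) f with search-Fin (λ i → DegLt-decide k (∂ i f))
  ... | inj₁ d             = inj₁ (derive d)
  ... | inj₂ (i , M , w)   = inj₂ (i ∷ M , w)

  -- A monomial of maximal degree keeps its coefficient under every restriction of the other variables.
  maximal-monomial : ∀ {N} d (f : Cube N → ℤ) → Deg d f →
    (∀ x y → f x ≡ f y) ⊎ ∃ λ k → Σ (Vec (Fin N) (suc k)) λ M → suc k ℕ.≤ d × (∀ x → ∂* M f x ≢ 0ℤ)
  maximal-monomial zero    f deg = inj₁ (Deg-zero-constant deg)
  maximal-monomial (suc d) f deg with DegLt-decide (suc d) f
  -- A derivative of the top order `suc d` has degree 0, so being nonzero at one point it is nonzero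
  -- everywhere.
  ... | inj₂ (M , x , ≢0) = inj₂ (d , M , ℕₚ.≤-refl , λ y ∂≡0 → ≢0 (trans (constant x y) ∂≡0))
    where
    constant : ∀ x y → ∂* M f x ≡ ∂* M f y
    constant = Deg-zero-constant (DegLt-∂* M (DegLt-≡ (cong suc (ℕₚ.+-comm 1 d)) deg))
  ... | inj₁ deg′ with maximal-monomial d f deg′
  ...   | inj₁ const               = inj₁ const
  ...   | inj₂ (k , M , k≤d , ≢0)  = inj₂ (k , M , ℕₚ.m≤n⇒m≤1+n k≤d , ≢0)

  -- The head is written last, so composing `f` with it first restricts `f` at `i`, in the same
  -- order in which `∂*` differentiates.
  overwrite : ∀ {N k} → Vec (Fin N) k → Vec Bool k → Cube N → Cube N
  overwrite []      []      x = x
  overwrite (i ∷ M) (v ∷ α) x = overwrite M α x [ i ]≔ v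

  DegLt-overwrite : ∀ {N k n} {f : Cube N → ℤ} (M : Vec (Fin N) k) α → DegLt n f → DegLt n (f ∘ overwrite M α)
  DegLt-overwrite []      []      d = d
  DegLt-overwrite (i ∷ M) (v ∷ α) d = DegLt-overwrite M α (DegLt-restrict i v d)

  -- Changing the block one variable at a time telescopes the difference; each summand is zero or a
  -- restricted `∂ i` up to sign.
  DegLt-overwrite-difference : ∀ {N k n} {f : Cube N → ℤ} (M : Vec (Fin N) k) α β → DegLt (suc n) f →
    DegLt n (λ x → f (overwrite M β x) - f (overwrite M α x))
  DegLt-overwrite-difference {f = f} [] [] [] d = vanishes λ x → +-inverseʳ (f x)
  DegLt-overwrite-difference {n = n} {f} (i ∷ M) (u ∷ α) (v ∷ β) d =
    DegLt-cong (λ x → telescope (f (overwrite M β x [ i ]≔ v)) (f (overwrite M α x [ i ]≔ v)) (f (overwrite M α x [ i ]≔ u)))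
      (DegLt-+ (DegLt-overwrite-difference M α β (DegLt-restrict i v d))
               (DegLt-overwrite M α (single u v)))
    where
    telescope : ∀ a b c → (a - b) + (b - c) ≡ a - c
    telescope = solve-∀
    flip : ∀ a b → - (a - b) ≡ b - a
    flip = solve-∀
    single : ∀ u v → DegLt n (λ x → f (x [ i ]≔ v) - f (x [ i ]≔ u))
    single false false = vanishes λ x → +-inverseʳ (f (x [ i ]≔ false))
    single true  true  = vanishes λ x → +-inverseʳ (f (x [ i ]≔ true))
    single false true  = DegLt-∂ d i
    single true  false = DegLt-cong (λ x → flip (f (x [ i ]≔ true)) (f (x [ i ]≔ false))) (DegLt-neg (DegLt-∂ d i))

  -- The iterated derivative is a signed sum of values on the subcube spanned by `M`.
  ∂*-vanishes : ∀ {N k} (M : Vec (Fin N) k) (f : Cube N → ℤ) x →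
    (∀ β → f (overwrite M β x) ≡ 0ℤ) → ∂* M f x ≡ 0ℤ
  ∂*-vanishes []      f x z = z []
  ∂*-vanishes (i ∷ M) f x z = ∂*-vanishes M (∂ i f) x λ β → cong₂ _-_ (z (true ∷ β)) (z (false ∷ β))

  -- If `f` were constantly `c` on the subcube, the first derivative would already cancel there;
  -- this is where `M` must be nonempty.
  sensitive : ∀ {N k} (M : Vec (Fin N) (suc k)) (f : Cube N → ℤ) x → ∂* M f x ≢ 0ℤ →
    ∀ c → ∃ λ β → f (overwrite M β x) ≢ c
  sensitive M@(i ∷ M′) f x ≢0 c
    with search-Cube {A = λ β → f (overwrite M β x) ≡ c} {B = λ β → f (overwrite M β x) ≢ c} dec
    where
    dec : ∀ β → f (overwrite M β x) ≡ c ⊎ f (overwrite M β x) ≢ c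
    dec β with f (overwrite M β x) ≟ c
    ... | yes p = inj₁ p
    ... | no ¬p = inj₂ ¬p
  ... | inj₂ w  = w
  ... | inj₁ eq = contradiction
    (∂*-vanishes M′ (∂ i f) x λ β → i≡j⇒i-j≡0 (trans (eq (true ∷ β)) (sym (eq (false ∷ β))))) ≢0

  -- Chain f n: n successive rounds, each of which fixes the variables of a maximal monomial.
  data Chain {N} : (Cube N → ℤ) → ℕ → Set where
    []  : ∀ {f} → Chain f 0
    add : ∀ {f n k} (M : Vec (Fin N) (suc k)) α → (∀ x → ∂* M f x ≢ 0ℤ) →
          Chain (f ∘ overwrite M α) n → Chain f (suc n)

  -- The decision tree.

  module Trees {N : ℕ} (output : ℤ → Bool) where

    TreeFor : (Cube N → ℤ) → ℕ → Set
    TreeFor f d = Σ (DTree N) λ T → depth T ℕ.≤ d × (∀ x → evalDT T x ≡ output (f (tabulate x)))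

    query-all : ∀ {k d} (M : Vec (Fin N) k) (f : Cube N → ℤ) →
      (∀ α → TreeFor (f ∘ overwrite M α) d) → TreeFor f (k ℕ.+ d)
    query-all []      f trees = trees []
    query-all (i ∷ M) f trees
      with query-all M (λ x → f (x [ i ]≔ false)) (λ α → trees (false ∷ α))
         | query-all M (λ x → f (x [ i ]≔ true))  (λ α → trees (true ∷ α))
    ... | l , l≤ , l-ok | r , r≤ , r-ok = node i l r , ℕ.s≤s (ℕₚ.⊔-lub l≤ r≤) , ok
      where
      -- On the branch actually taken, overwriting `i` by the queried bit changes nothing, so the
      -- subtree's answer is the one for `f`.
      consistent : ∀ x → tabulate x [ i ]≔ x i ≡ tabulate x
      consistent x = trans (cong (tabulate x [ i ]≔_) (sym (lookup∘tabulate x i))) ([]≔-lookup (tabulate x) i)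
      ok : ∀ x → evalDT (node i l r) x ≡ output (f (tabulate x))
      ok x with x i | consistent x
      ... | false | eq = trans (l-ok x) (cong (output ∘ f) eq)
      ... | true  | eq = trans (r-ok x) (cong (output ∘ f) eq)

    weaken : ∀ f {d d′} → d ℕ.≤ d′ → TreeFor f d → TreeFor f d′
    weaken f d≤d′ (T , T≤d , ok) = T , ℕₚ.≤-trans T≤d d≤d′ , ok

    -- Each round costs at most `d` queries, and a nonconstant restriction left after `m` rounds
    -- would extend the path to a chain of length `suc m`.
    tree : ∀ m d f → Deg d f → ¬ Chain f (suc m) → TreeFor f (m ℕ.* d)
    tree m d f deg no-chain with maximal-monomial d f deg
    ... | inj₁ const = leaf (output (f (tabulate λ _ → false))) , ℕ.z≤n , λ x → cong output (const _ _)
    tree zero    d f deg no-chain | inj₂ (k , M , k≤d , ≢0) =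
      contradiction (add M (tabulate λ _ → false) ≢0 []) no-chain
    tree (suc m) d f deg no-chain | inj₂ (k , M , k≤d , ≢0) =
      weaken f (ℕₚ.+-monoˡ-≤ (m ℕ.* d) k≤d) (query-all M f λ α →
        tree m d (f ∘ overwrite M α) (DegLt-overwrite M α deg) λ c → no-chain (add M α ≢0 c))

-- Bounding the number of rounds by random block assignments.

module ChainLength where

  open EvenPolynomials
  open BooleanCube
  open import Data.Nat as ℕ using (ℕ; zero; suc)
  import Data.Nat.Properties as ℕₚ
  import Data.Nat.Tactic.RingSolver as ℕ-Solver
  open import Data.Bool using (Bool)
  open import Data.Fin using (Fin)
  open import Data.Integer hiding (suc; NonZero)
  open import Data.Integer.Properties
  open import Data.Integer.Tactic.RingSolver using (solve-∀)
  open import Data.List using (List; []; _∷_; length)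
  open import Data.Product using (∃; _×_; _,_)
  open import Data.Vec using (Vec)
  open import Function using (_∘_)
  open import Relation.Binary using (tri<; tri≈; tri>)
  open import Relation.Binary.PropositionalEquality
  open import Relation.Nullary using (contradiction)

  record Block (N : ℕ) : Set where
    constructor block
    field
      {size} : ℕ
      vars   : Vec (Fin N) size
      low    : Vec Bool size
      high   : Vec Bool size

  ρ₀ ρ₁ : ∀ {N} → Block N → Cube N → Cube N
  ρ₀ (block M α β) = overwrite M α
  ρ₁ (block M α β) = overwrite M β

  jump : ∀ {N} → Block N → (Cube N → ℤ) → Cube N → ℤ
  jump B f x = f (ρ₁ B x) - f (ρ₀ B x)

  jump-DegLt : ∀ {N n} {f : Cube N → ℤ} (B : Block N) → DegLt (suc n) f → DegLt n (jump B f)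
  jump-DegLt (block M α β) = DegLt-overwrite-difference M α β

  base : ∀ {N} → List (Block N) → Cube N → Cube N
  base []       x = x
  base (B ∷ Bs) x = ρ₀ B (base Bs x)

  -- Each block is raised alone, with all others low: the first-order term of the expectation at
  -- probability 0.
  totalJump : ∀ {N} → List (Block N) → (Cube N → ℤ) → Cube N → ℤ
  totalJump []       f x = 0ℤ
  totalJump (B ∷ Bs) f x = totalJump Bs (f ∘ ρ₀ B) x + jump B f (base Bs x)

  -- M ^ length Bs times the expectation of f when each block is independently
  -- set to its high value with probability a / M and to its low value otherwise.
  expect : ∀ {N} → ℤ → ℤ → List (Block N) → (Cube N → ℤ) → Cube N → ℤ
  expect M a []       f x = f x
  expect M a (B ∷ Bs) f x = (M - a) * expect M a Bs (f ∘ ρ₀ B) x + a * expect M a Bs (f ∘ ρ₁ B) x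

  -- The difference quotient of expect between 0 and a; see expect-split.
  slope : ∀ {N} → ℤ → ℤ → List (Block N) → (Cube N → ℤ) → Cube N → ℤ
  slope M a []       f x = 0ℤ
  slope M a (B ∷ Bs) f x = M * slope M a Bs (f ∘ ρ₀ B) x + expect M a Bs (jump B f) x

  expect-difference : ∀ {N} M a (Bs : List (Block N)) f g x →
    expect M a Bs (λ y → f y - g y) x ≡ expect M a Bs f x - expect M a Bs g x
  expect-difference M a []       f g x = refl
  expect-difference M a (B ∷ Bs) f g x = trans
    (cong₂ (λ u v → (M - a) * u + a * v)
           (expect-difference M a Bs (f ∘ ρ₀ B) (g ∘ ρ₀ B) x) (expect-difference M a Bs (f ∘ ρ₁ B) (g ∘ ρ₁ B) x))
    (rearrange (M - a) a (expect M a Bs (f ∘ ρ₀ B) x) (expect M a Bs (g ∘ ρ₀ B) x)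
                         (expect M a Bs (f ∘ ρ₁ B) x) (expect M a Bs (g ∘ ρ₁ B) x))
    where
    rearrange : ∀ b a u v u′ v′ → b * (u - v) + a * (u′ - v′) ≡ (b * u + a * u′) - (b * v + a * v′)
    rearrange = solve-∀

  -- Collecting the factor `a` pairs it with a jump, which has smaller degree than `f`.
  expect-jump : ∀ {N} M a (B : Block N) Bs f x →
    expect M a (B ∷ Bs) f x ≡ M * expect M a Bs (f ∘ ρ₀ B) x + a * expect M a Bs (jump B f) x
  expect-jump M a B Bs f x = trans
    (rearrange M a (expect M a Bs (f ∘ ρ₀ B) x) (expect M a Bs (f ∘ ρ₁ B) x))
    (cong (λ u → M * expect M a Bs (f ∘ ρ₀ B) x + a * u) (sym (expect-difference M a Bs (f ∘ ρ₁ B) (f ∘ ρ₀ B) x)))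
    where
    rearrange : ∀ M a u v → (M - a) * u + a * v ≡ M * u + a * (v - u)
    rearrange = solve-∀

  expect-split : ∀ {N} M a (Bs : List (Block N)) f x →
    expect M a Bs f x ≡ M ^ length Bs * f (base Bs x) + a * slope M a Bs f x
  expect-split M a []       f x = sym (trans (cong₂ _+_ (*-identityˡ (f x)) (*-zeroʳ a)) (+-identityʳ (f x)))
  expect-split M a (B ∷ Bs) f x = begin
    expect M a (B ∷ Bs) f x
      ≡⟨ expect-jump M a B Bs f x ⟩
    M * expect M a Bs (f ∘ ρ₀ B) x + a * e
      ≡⟨ cong (λ u → M * u + a * e) (expect-split M a Bs (f ∘ ρ₀ B) x) ⟩
    M * (p * v + a * s) + a * e
      ≡⟨ rearrange M a p v s e ⟩
    (M * p) * v + a * (M * s + e) ∎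
    where
    open ≡-Reasoning
    p v s e : ℤ
    p = M ^ length Bs
    v = f (ρ₀ B (base Bs x))
    s = slope M a Bs (f ∘ ρ₀ B) x
    e = expect M a Bs (jump B f) x
    rearrange : ∀ M a p v s e → M * (p * v + a * s) + a * e ≡ (M * p) * v + a * (M * s + e)
    rearrange = solve-∀

  -- At `a = 0` only base values survive. For nonempty `Bs` the slope carries one power of `M` less
  -- than `expect`; multiplying by `M` restores it without division.
  slope-zero : ∀ {N} M (Bs : List (Block N)) f x →
    M * slope M 0ℤ Bs f x ≡ M ^ length Bs * totalJump Bs f x
  slope-zero M []       f x = *-zeroʳ M
  slope-zero M (B ∷ Bs) f x = begin
    M * (M * s + expect M 0ℤ Bs (jump B f) x)
      ≡⟨ cong (λ u → M * (M * s + u)) (trans (expect-split M 0ℤ Bs (jump B f) x) (+-identityʳ _)) ⟩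
    M * (M * s + p * j)
      ≡⟨ cong (λ u → M * (u + p * j)) (slope-zero M Bs (f ∘ ρ₀ B) x) ⟩
    M * (p * t + p * j)
      ≡⟨ rearrange M p t j ⟩
    (M * p) * (t + j) ∎
    where
    open ≡-Reasoning
    p s t j : ℤ
    p = M ^ length Bs
    s = slope M 0ℤ Bs (f ∘ ρ₀ B) x
    t = totalJump Bs (f ∘ ρ₀ B) x
    j = jump B f (base Bs x)
    rearrange : ∀ M p t j → M * (p * t + p * j) ≡ (M * p) * (t + j)
    rearrange = solve-∀

  DegLt-ρ₀ : ∀ {N n} {f : Cube N → ℤ} (B : Block N) → DegLt n f → DegLt n (f ∘ ρ₀ B)
  DegLt-ρ₀ (block M α β) = DegLt-overwrite M α

  expect-vanishes : ∀ {N} M a (Bs : List (Block N)) {f} x → (∀ y → f y ≡ 0ℤ) → expect M a Bs f x ≡ 0ℤ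
  expect-vanishes M a []       x z = z x
  expect-vanishes M a (B ∷ Bs) x z = trans
    (cong₂ (λ u v → (M - a) * u + a * v) (expect-vanishes M a Bs x (z ∘ ρ₀ B)) (expect-vanishes M a Bs x (z ∘ ρ₁ B)))
    (cong₂ _+_ (*-zeroʳ (M - a)) (*-zeroʳ a))

  -- By `expect-jump`, every factor `t * t` is paid for by one degree of `f`.
  expect-PolLt : ∀ {N} M (Bs : List (Block N)) d {f} x → DegLt d f → PolLt (d ℕ.+ d) (λ t → expect M (t * t) Bs f x)
  expect-PolLt M Bs       zero        x deg = vanishes λ t → expect-vanishes M (t * t) Bs x (DegLt-zero deg)
  expect-PolLt M []       (suc d) {f} x deg = PolLt-const (f x)
  expect-PolLt M (B ∷ Bs) (suc d) {f} x deg = PolLt-cong (λ t → sym (expect-jump M (t * t) B Bs f x))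
    (PolLt-+ (PolLt-scale M (expect-PolLt M Bs (suc d) x (DegLt-ρ₀ B deg)))
             (PolLt-≡ (cong suc (sym (ℕₚ.+-suc d d))) (PolLt-t²* (expect-PolLt M Bs d x (jump-DegLt B deg)))))
    where
    PolLt-≡ : ∀ {m n P} → m ≡ n → PolLt m P → PolLt n P
    PolLt-≡ refl p = p

  -- Dividing out `t * t` saves two degrees compared with `expect`, which is what makes the nodes up
  -- to `d` suffice in `markov`.
  slope-PolLt : ∀ {N} M (Bs : List (Block N)) d {f} x → Deg d f → PolLt (d ℕ.+ d) (λ t → slope M (t * t) Bs f x)
  slope-PolLt M []       d x deg = vanishes λ _ → refl
  slope-PolLt M (B ∷ Bs) d x deg =
    PolLt-+ (PolLt-scale M (slope-PolLt M Bs d x (DegLt-ρ₀ B deg))) (expect-PolLt M Bs d x (jump-DegLt B deg))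

  *-nonneg : ∀ {i j} → 0ℤ ≤ i → 0ℤ ≤ j → 0ℤ ≤ i * j
  *-nonneg {+ m} {+ n} _ _ = subst (0ℤ ≤_) (pos-* m n) (+≤+ ℕ.z≤n)

  *-monoˡ : ∀ {i j k} → 0ℤ ≤ i → j ≤ k → i * j ≤ i * k
  *-monoˡ {+ m} _ j≤k = *-monoˡ-≤-nonNeg (+ m) j≤k

  module _ {N : ℕ} (M a : ℤ) (0≤a : 0ℤ ≤ a) (a≤M : a ≤ M) where

    private
      0≤M-a : 0ℤ ≤ M - a
      0≤M-a = i≤j⇒0≤j-i a≤M

    expect-nonneg : ∀ (Bs : List (Block N)) {f} x → (∀ y → 0ℤ ≤ f y) → 0ℤ ≤ expect M a Bs f x
    expect-nonneg []       x nn = nn x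
    expect-nonneg (B ∷ Bs) x nn =
      +-mono-≤ (*-nonneg 0≤M-a (expect-nonneg Bs x (nn ∘ ρ₀ B))) (*-nonneg 0≤a (expect-nonneg Bs x (nn ∘ ρ₁ B)))

    expect-≤ : ∀ (Bs : List (Block N)) {f} x c → (∀ y → f y ≤ c) → expect M a Bs f x ≤ M ^ length Bs * c
    expect-≤ []       {f} x c ≤c = subst (f x ≤_) (sym (*-identityˡ c)) (≤c x)
    expect-≤ (B ∷ Bs) x c ≤c = ≤-trans
      (+-mono-≤ (*-monoˡ 0≤M-a (expect-≤ Bs x c (≤c ∘ ρ₀ B))) (*-monoˡ 0≤a (expect-≤ Bs x c (≤c ∘ ρ₁ B))))
      (≤-reflexive (collect M a (M ^ length Bs) c))
      where
      collect : ∀ M a p c → (M - a) * (p * c) + a * (p * c) ≡ (M * p) * c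
      collect = solve-∀

  ∣difference∣ : ∀ {u v w} → 0ℤ ≤ u → u ≤ w → 0ℤ ≤ v → v ≤ w → ∣ u - v ∣ ℕ.≤ ∣ w ∣
  ∣difference∣ {+ m} {+ n} {+ k} _ (+≤+ m≤k) _ (+≤+ n≤k) = subst (ℕ._≤ k) (cong ∣_∣ (sym (m-n≡m⊖n m n)))
    (ℕₚ.≤-trans (∣m⊝n∣≤m⊔n m n) (ℕₚ.⊔-lub m≤k n≤k))

  -- `a * slope` is the difference of the scaled expectations at `a` and at 0, and both lie between
  -- 0 and `M ^ length Bs * S`.
  slope-bound : ∀ {N} S d (Bs : List (Block N)) {f} x → (∀ y → 0ℤ ≤ f y) → (∀ y → f y ≤ + S) →
    ∀ j → j ℕ.≤ d → j ℕ.* j ℕ.* ∣ slope (+ (d ℕ.* d)) (+ j * + j) Bs f x ∣ ℕ.≤ ∣ (+ (d ℕ.* d)) ^ length Bs ∣ ℕ.* S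
  slope-bound S d Bs {f} x f≥0 f≤S j j≤d = begin
    j ℕ.* j ℕ.* ∣ s ∣
      ≡⟨ cong (ℕ._* ∣ s ∣) (sym (∣i*j∣≡∣i∣*∣j∣ (+ j) (+ j))) ⟩
    ∣ a ∣ ℕ.* ∣ s ∣
      ≡⟨ sym (∣i*j∣≡∣i∣*∣j∣ a s) ⟩
    ∣ a * s ∣
      ≡⟨ cong ∣_∣ (trans (isolate (p * v) (a * s)) (cong (_- p * v) (sym (expect-split M a Bs f x)))) ⟩
    ∣ expect M a Bs f x - p * v ∣
      ≤⟨ ∣difference∣ (expect-nonneg M a 0≤a a≤M Bs x f≥0) (expect-≤ M a 0≤a a≤M Bs x (+ S) f≤S)
                      (*-nonneg 0≤p (f≥0 _)) (*-monoˡ 0≤p (f≤S _)) ⟩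
    ∣ p * + S ∣
      ≡⟨ ∣i*j∣≡∣i∣*∣j∣ p (+ S) ⟩
    ∣ p ∣ ℕ.* S ∎
    where
    open ℕₚ.≤-Reasoning
    M a p s v : ℤ
    M = + (d ℕ.* d)
    a = + j * + j
    p = M ^ length Bs
    s = slope M a Bs f x
    v = f (base Bs x)
    0≤a : 0ℤ ≤ a
    0≤a = *-nonneg {+ j} {+ j} (+≤+ ℕ.z≤n) (+≤+ ℕ.z≤n)
    a≤M : a ≤ M
    a≤M = subst (_≤ M) (pos-* j j) (+≤+ (ℕₚ.*-mono-≤ j≤d j≤d))
    0≤p : 0ℤ ≤ p
    0≤p = power-nonneg (length Bs)
      where
      power-nonneg : ∀ n → 0ℤ ≤ M ^ n
      power-nonneg zero    = +≤+ ℕ.z≤n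
      power-nonneg (suc n) = *-nonneg {M} (+≤+ ℕ.z≤n) (power-nonneg n)
    isolate : ∀ u v → v ≡ (u + v) - u
    isolate = solve-∀

  slope-Even : ∀ {N} M (Bs : List (Block N)) f x → Even (λ t → slope M (t * t) Bs f x)
  slope-Even M Bs f x t = cong (λ a → slope M a Bs f x) (square t)
    where
    square : ∀ t → - t * - t ≡ t * t
    square = solve-∀

  -- The power of `M` cancels; the factor `d * d` comes from the scale `t²/d²` of the probabilities.
  totalJump-from-slope : ∀ {N} S d K (Bs : List (Block N)) f x → .{{ℕ.NonZero d}} →
    ∣ slope (+ (d ℕ.* d)) 0ℤ Bs f x ∣ ℕ.≤ K ℕ.* (∣ (+ (d ℕ.* d)) ^ length Bs ∣ ℕ.* S) →
    ∣ totalJump Bs f x ∣ ℕ.≤ K ℕ.* (d ℕ.* d ℕ.* S)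
  totalJump-from-slope S d K Bs f x ≤W = ℕₚ.*-cancelˡ-≤ ∣ p ∣ {{power-nonzero (length Bs)}} (begin
    ∣ p ∣ ℕ.* ∣ totalJump Bs f x ∣
      ≡⟨ sym (∣i*j∣≡∣i∣*∣j∣ p (totalJump Bs f x)) ⟩
    ∣ p * totalJump Bs f x ∣
      ≡⟨ cong ∣_∣ (sym (slope-zero M Bs f x)) ⟩
    ∣ M * slope M 0ℤ Bs f x ∣
      ≡⟨ ∣i*j∣≡∣i∣*∣j∣ M (slope M 0ℤ Bs f x) ⟩
    d ℕ.* d ℕ.* ∣ slope M 0ℤ Bs f x ∣
      ≤⟨ ℕₚ.*-monoʳ-≤ (d ℕ.* d) ≤W ⟩
    d ℕ.* d ℕ.* (K ℕ.* (∣ p ∣ ℕ.* S))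
      ≡⟨ rearrange (d ℕ.* d) K ∣ p ∣ S ⟩
    ∣ p ∣ ℕ.* (K ℕ.* (d ℕ.* d ℕ.* S)) ∎)
    where
    open ℕₚ.≤-Reasoning
    M p : ℤ
    M = + (d ℕ.* d)
    p = M ^ length Bs
    power-nonzero : ∀ n → ℕ.NonZero ∣ M ^ n ∣
    power-nonzero zero    = _
    power-nonzero (suc n) = subst ℕ.NonZero (sym (∣i*j∣≡∣i∣*∣j∣ M (M ^ n)))
      (ℕₚ.m*n≢0 (d ℕ.* d) ∣ M ^ n ∣ {{ℕₚ.m*n≢0 d d}} {{power-nonzero n}})
    rearrange : ∀ D K p S → D ℕ.* (K ℕ.* (p ℕ.* S)) ≡ p ℕ.* (K ℕ.* (D ℕ.* S))
    rearrange = ℕ-Solver.solve-∀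

  module _ {N : ℕ} (S : ℕ) {f : Cube N → ℤ} (f≥0 : ∀ y → 0ℤ ≤ f y) (f≤S : ∀ y → f y ≤ + S) where

    totalJump-bound : ∀ d (Bs : List (Block N)) x → Deg (suc d) f →
      ∣ totalJump Bs f x ∣ ℕ.≤ 4 ℕ.* (suc d ℕ.* suc d ℕ.* S)
    totalJump-bound d Bs x deg = totalJump-from-slope S (suc d) 4 Bs f x
      (markov (∣ M ^ length Bs ∣ ℕ.* S) (suc d) (λ t → slope M (t * t) Bs f x) (slope-Even M Bs f x)
        (slope-PolLt M Bs (suc d) x deg) (slope-bound S (suc d) Bs x f≥0 f≤S))
      where
      M : ℤ
      M = + (suc d ℕ.* suc d)

    totalJump-bound-linear : ∀ (Bs : List (Block N)) x → Deg 1 f → ∣ totalJump Bs f x ∣ ℕ.≤ 1 ℕ.* (1 ℕ.* S)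
    totalJump-bound-linear Bs x deg = totalJump-from-slope S 1 1 Bs f x
      (subst (∣ slope (+ 1) 0ℤ Bs f x ∣ ℕ.≤_) (sym (ℕₚ.*-identityˡ _))
        (markov-linear (∣ (+ 1) ^ length Bs ∣ ℕ.* S) (λ t → slope (+ 1) (t * t) Bs f x) (slope-Even (+ 1) Bs f x)
          (slope-PolLt (+ 1) Bs 1 x deg)
          (subst (ℕ._≤ _) (ℕₚ.*-identityˡ _) (slope-bound S 1 Bs x f≥0 f≤S 1 ℕₚ.≤-refl))))

  i<j⇒1≤j-i : ∀ {i j} → i < j → 1ℤ ≤ j - i
  i<j⇒1≤j-i {i} {j} i<j = ≤-trans (≤-reflexive (one i)) (+-monoˡ-≤ (- i) (i<j⇒suc[i]≤j i<j))
    where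
    one : ∀ i → 1ℤ ≡ (1ℤ + i) - i
    one i = sym (trans (+-assoc 1ℤ i (- i)) (cong (λ u → 1ℤ + u) (+-inverseʳ i)))

  -- Up-jumps and down-jumps are collected separately: a block whose jump has the
  -- wrong sign is kept with high = low, so that both lists have the same base point.
  chain-jumps : ∀ {N n} {f : Cube N → ℤ} → Chain f n → ∀ x →
    ∃ λ Bs⁺ → ∃ λ Bs⁻ → base Bs⁺ x ≡ base Bs⁻ x × + n ≤ totalJump Bs⁺ f x - totalJump Bs⁻ f x
  chain-jumps [] x = [] , [] , refl , ≤-refl
  chain-jumps {n = suc n} {f} (add M α ≢0 c) x with chain-jumps c x
  -- The coefficient is nonzero at every point, hence also at the base point fixed by the later
  -- rounds.
  ... | Bs⁺ , Bs⁻ , same , n≤ with sensitive M f (base Bs⁺ x) (≢0 (base Bs⁺ x)) (f (overwrite M α (base Bs⁺ x)))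
  ...   | β , differs with <-cmp (f (overwrite M β (base Bs⁺ x))) (f (overwrite M α (base Bs⁺ x)))
  ...     | tri≈ _ eq _ = contradiction eq differs
  ...     | tri> _ _ α<β = block M α β ∷ Bs⁺ , block M α α ∷ Bs⁻ , cong (overwrite M α) same ,
    ≤-trans (+-mono-≤ (i<j⇒1≤j-i α<β) n≤)
      (≤-reflexive (rearrange (f (overwrite M β (base Bs⁺ x))) (f (overwrite M α (base Bs⁺ x)))
        (totalJump Bs⁺ (f ∘ overwrite M α) x) (totalJump Bs⁻ (f ∘ overwrite M α) x) (f (overwrite M α (base Bs⁻ x)))))
    where
    rearrange : ∀ b a t s c → (b - a) + (t - s) ≡ (t + (b - a)) - (s + (c - c))
    rearrange = solve-∀
  ...     | tri< β<α _ _ = block M α α ∷ Bs⁺ , block M α β ∷ Bs⁻ , cong (overwrite M α) same ,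
    -- The down-jump is measured at the base point of `Bs⁻`; `same` carries over the comparison made
    -- at that of `Bs⁺`.
    subst (λ z → + suc n ≤ totalJump (block M α α ∷ Bs⁺) f x - (totalJump Bs⁻ (f ∘ overwrite M α) x + jump (block M α β) f z)) same
     (≤-trans (+-mono-≤ (i<j⇒1≤j-i β<α) n≤)
      (≤-reflexive (rearrange (f (overwrite M β (base Bs⁺ x))) (f (overwrite M α (base Bs⁺ x)))
        (totalJump Bs⁺ (f ∘ overwrite M α) x) (totalJump Bs⁻ (f ∘ overwrite M α) x))))
    where
    rearrange : ∀ b a t s → (a - b) + (t - s) ≡ (t + (a - a)) - (s + (b - a))
    rearrange = solve-∀

  chain-length : ∀ {N n K} {f : Cube N → ℤ} → (∀ Bs x → ∣ totalJump Bs f x ∣ ℕ.≤ K) → Cube N → Chain f n → n ℕ.≤ K ℕ.+ K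
  chain-length {n = n} {K} {f} bound x c with chain-jumps c x
  ... | Bs⁺ , Bs⁻ , _ , n≤ = ℕₚ.≤-trans (∣∣-mono (+≤+ ℕ.z≤n) n≤)
    (ℕₚ.≤-trans (∣i-j∣≤∣i∣+∣j∣ (totalJump Bs⁺ f x) (totalJump Bs⁻ f x)) (ℕₚ.+-mono-≤ (bound Bs⁺ x) (bound Bs⁻ x)))

-- Degree growth through the rounds of an algorithm.

module AMPC where

  open BooleanCube
  open import Data.Nat as ℕ using (ℕ; zero; suc; _≤_; _≤?_; z≤n; s≤s)
  import Data.Nat.Properties as ℕₚ
  import Data.Nat.Tactic.RingSolver as ℕ-Solver
  open import Data.Bool using (Bool; true; false)
  open import Data.Fin using (Fin; zero; suc; toℕ; fromℕ)
  import Data.Fin.Properties as Finₚ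
  open import Data.Integer as ℤ using (ℤ; +_; _+_; _-_; _*_; 0ℤ; 1ℤ)
  open import Data.Integer.Properties using (+-identityˡ; +-identityʳ; +-inverseʳ; *-identityˡ; *-zeroʳ; pos-+)
  open import Data.Integer.Tactic.RingSolver using (solve-∀)
  open import Data.List using (List; []; _∷_; [_]; _++_; map; filter; length; concatMap; allFin)
  open import Data.List.Properties using (≡-dec; length-++; filter-++; filter-none; map-++)
  open import Data.List.Membership.Propositional using (_∈_; _∉_)
  open import Data.List.Membership.Propositional.Properties using (∈-map⁺; ∈-++⁺ˡ; ∈-++⁺ʳ)
  open import Data.List.Membership.DecPropositional (≡-dec ℕₚ._≟_) using (_∈?_)
  open import Data.List.Relation.Unary.All as All using (All)
  import Data.List.Relation.Unary.All.Properties as Allₚ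
  open import Data.List.Relation.Unary.AllPairs using (_∷_)
  open import Data.List.Relation.Unary.Any using (here; there)
  open import Data.List.Relation.Unary.Unique.Propositional using (Unique)
  open import Data.List.Relation.Unary.Unique.Propositional.Properties using (allFin⁺)
  open import Data.Maybe using (Maybe; just; nothing)
  open import Data.Product using (∃; _×_; _,_; proj₁; proj₂)
  open import Data.Vec using ([]; _∷_; lookup)
  open import Function using (_∘_)
  open import Relation.Binary.PropositionalEquality hiding ([_])
  open import Relation.Nullary using (Dec; yes; no; contradiction)

  indicator : List Val → List Val → ℤ
  indicator r a with ≡-dec ℕₚ._≟_ r a
  ... | yes _ = 1ℤ
  ... | no  _ = 0ℤ

  indicator-refl : ∀ {r a} → r ≡ a → indicator r a ≡ 1ℤ
  indicator-refl {r} {a} r≡a with ≡-dec ℕₚ._≟_ r a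
  ... | yes _   = refl
  ... | no  r≢a = contradiction r≡a r≢a

  indicator-≢ : ∀ {r a} → r ≢ a → indicator r a ≡ 0ℤ
  indicator-≢ {r} {a} r≢a with ≡-dec ℕₚ._≟_ r a
  ... | yes r≡a = contradiction r≡a r≢a
  ... | no  _   = refl

  indicator-nonzero : ∀ {r a} → indicator r a ≢ 0ℤ → r ≡ a
  indicator-nonzero {r} {a} ≢0 with ≡-dec ℕₚ._≟_ r a
  ... | yes r≡a = r≡a
  ... | no  _   = contradiction refl ≢0

  cubes : ∀ N → List (Cube N)
  cubes zero    = [ [] ]
  cubes (suc N) = map (false ∷_) (cubes N) ++ map (true ∷_) (cubes N)

  ∈-cubes : ∀ {N} (x : Cube N) → x ∈ cubes N
  ∈-cubes []          = here refl
  ∈-cubes (false ∷ x) = ∈-++⁺ˡ (∈-map⁺ (false ∷_) (∈-cubes x))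
  ∈-cubes {suc N} (true ∷ x) = ∈-++⁺ʳ (map (false ∷_) (cubes N)) (∈-map⁺ (true ∷_) (∈-cubes x))

  module _ {N : ℕ} where

    -- Responses range over an infinite type, but `h` takes finitely many values on the cube, so
    -- `G (h x) x` is a finite sum over those values `a` of indicator times `G a x`.
    DegLt-by-cases : ∀ {n} (h : Cube N → List Val) (G : List Val → Cube N → ℤ) →
      (∀ a → DegLt n (λ x → indicator (h x) a * G a x)) → DegLt n (λ x → G (h x) x)
    DegLt-by-cases {n} h G deg with partial (map h (cubes N))
      where
      partial : ∀ L → ∃ λ F → DegLt n F × (∀ x → h x ∈ L → F x ≡ G (h x) x) × (∀ x → h x ∉ L → F x ≡ 0ℤ)
      partial [] = (λ _ → 0ℤ) , vanishes (λ _ → refl) , (λ _ ()) , λ _ _ → refl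
      partial (a ∷ L) with partial L
      ... | F , F-deg , F-in , F-out with a ∈? L
      -- Values already listed are skipped, so that none is summed twice.
      ...   | yes a∈L = F , F-deg , (λ { x (here refl) → F-in x a∈L ; x (there ∈L) → F-in x ∈L }) ,
                        λ x ∉L → F-out x (∉L ∘ there)
      ...   | no  a∉L = (λ x → indicator (h x) a * G a x + F x) , DegLt-+ (deg a) F-deg , inside , outside
        where
        inside : ∀ x → h x ∈ a ∷ L → indicator (h x) a * G a x + F x ≡ G (h x) x
        inside x (here hx≡a) = trans
          (cong₂ (λ u v → u * G a x + v) (indicator-refl hx≡a) (F-out x (λ hx∈L → a∉L (subst (_∈ L) hx≡a hx∈L))))
          (trans (+-identityʳ _) (trans (*-identityˡ _) (cong (λ r → G r x) (sym hx≡a))))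
        inside x (there hx∈L) = trans
          (cong₂ (λ u v → u * G a x + v) (indicator-≢ {h x} {a} (λ hx≡a → a∉L (subst (_∈ L) hx≡a hx∈L))) (F-in x hx∈L))
          (+-identityˡ _)
        outside : ∀ x → h x ∉ a ∷ L → indicator (h x) a * G a x + F x ≡ 0ℤ
        outside x ∉aL = cong₂ (λ u v → u * G a x + v)
          (indicator-≢ {h x} {a} (∉aL ∘ here)) (F-out x (∉aL ∘ there))
    ... | F , F-deg , F-in , _ = DegLt-cong (λ x → F-in x (∈-map⁺ h (∈-cubes x))) F-deg

    -- Quantifying over all `φ` covers indicators as well as sorting, filtering and counting.
    FunDeg : ℕ → (Cube N → List Val) → Set
    FunDeg d h = ∀ (φ : List Val → ℤ) → Deg d (φ ∘ h)

    Deg-mono : ∀ {m n} {f : Cube N → ℤ} → m ≤ n → Deg m f → Deg n f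
    Deg-mono m≤n = DegLt-mono (s≤s m≤n)

    -- The response is a parameter here, so that it can be summed over by `DegLt-by-cases`.
    afterResponse : ℕ → Store → (List Val → Prog) → List Val → Maybe (List (Key × Val))
    afterResponse b D c ρ with cost ρ ≤? b
    ... | yes _ = run (b ℕ.∸ cost ρ) D (c ρ)
    ... | no  _ = nothing

    run-query : ∀ b D k c → afterResponse b D c (response k D) ≡ run b D (query k c)
    run-query b D k c with cost (response k D) ≤? b
    ... | yes _ = refl
    ... | no  _ = refl

    cost-positive : ∀ ρ → 1 ≤ cost ρ
    cost-positive []      = s≤s z≤n
    cost-positive (_ ∷ _) = s≤s z≤n

    -- On a branch `ρ` the indicator contributes degree `d`, and the rest runs on a strictly smaller
    -- budget because even an empty response costs 1.
    run-Deg : ∀ {d} (D : Cube N → Store) → (∀ k → FunDeg d (λ x → response k (D x))) →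
      ∀ p b (φ : Maybe (List (Key × Val)) → ℤ) → Deg (b ℕ.* d) (λ x → φ (run b (D x) p))
    run-Deg D D-deg (write ws)  b    φ = DegLt-const (φ (just ws))
    run-Deg {d} D D-deg (query k c) zero φ = DegLt-cong (λ x → cong φ (sym (stuck x))) (DegLt-const (φ nothing))
      where
      stuck : ∀ x → run 0 (D x) (query k c) ≡ nothing
      stuck x with cost (response k (D x)) ≤? 0
      ... | yes cost≤0 = contradiction (ℕₚ.≤-trans (cost-positive (response k (D x))) cost≤0) λ ()
      ... | no  _      = refl
    run-Deg {d} D D-deg (query k c) (suc b) φ = DegLt-cong (λ x → cong φ (run-query (suc b) (D x) k c))
      (DegLt-by-cases (λ x → response k (D x)) (λ ρ x → φ (afterResponse (suc b) (D x) c ρ)) branch)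
      where
      branch : ∀ ρ → Deg (suc b ℕ.* d) (λ x → indicator (response k (D x)) ρ * φ (afterResponse (suc b) (D x) c ρ))
      branch ρ with cost ρ ≤? suc b
      ... | yes _ = Deg-mono (ℕₚ.+-monoʳ-≤ d (ℕₚ.*-monoˡ-≤ d (ℕₚ.∸-monoʳ-≤ (suc b) (cost-positive ρ))))
        (Deg-* (D-deg k (λ r → indicator r ρ)) (run-Deg D D-deg (c ρ) (suc b ℕ.∸ cost ρ) φ))
      ... | no  _ = Deg-mono (ℕₚ.+-monoʳ-≤ d z≤n)
        (Deg-* (D-deg k (λ r → indicator r ρ)) (DegLt-const (φ nothing)))

    -- Where χ is nonzero at most s values remain, so a product of more than s
    -- "machine p writes here" indicators with χ vanishes identically.
    concatMap-Deg : ∀ {P : Set} {e} (h : P → Cube N → List Val) → (∀ p → FunDeg e (h p)) →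
      ∀ ps s {c} (χ : Cube N → ℤ) → Deg c χ →
      (∀ x → χ x ≢ 0ℤ → length (concatMap (λ p → h p x) ps) ≤ s) →
      ∀ (ψ : List Val → ℤ) → Deg (c ℕ.+ s ℕ.* e) (λ x → χ x * ψ (concatMap (λ p → h p x) ps))
    concatMap-Deg {e = e} h h-deg [] s {c} χ χ-deg short ψ = Deg-mono (ℕₚ.+-monoʳ-≤ c z≤n)
      (Deg-* χ-deg (DegLt-const (ψ [])))
    concatMap-Deg {e = e} h h-deg (p ∷ ps) s {c} χ χ-deg short ψ =
      -- The first summand ignores machine `p`; the second is its correction, split by what `p`
      -- writes under the key.
      DegLt-cong (λ x → split (χ x) (ψ (rest x)) (ψ (h p x ++ rest x)))
        (DegLt-+ (concatMap-Deg h h-deg ps s χ χ-deg rest-short ψ)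
                 (DegLt-by-cases (h p) (λ ρ x → χ x * (ψ (ρ ++ rest x) - ψ (rest x))) (branch s short)))
      where
      rest : Cube N → List Val
      rest x = concatMap (λ q → h q x) ps
      split : ∀ a b c → a * b + a * (c - b) ≡ a * c
      split = solve-∀
      rest-short : ∀ x → χ x ≢ 0ℤ → length (rest x) ≤ s
      rest-short x χ≢0 = ℕₚ.≤-trans (ℕₚ.m≤n+m _ (length (h p x)))
        (ℕₚ.≤-trans (ℕₚ.≤-reflexive (sym (length-++ (h p x)))) (short x χ≢0))
      branch : ∀ s → (∀ x → χ x ≢ 0ℤ → length (h p x ++ rest x) ≤ s) →
        ∀ ρ → Deg (c ℕ.+ s ℕ.* e) (λ x → indicator (h p x) ρ * (χ x * (ψ (ρ ++ rest x) - ψ (rest x))))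
      branch s short [] = vanishes λ x → trans
        (cong (λ u → indicator (h p x) [] * (χ x * u)) (+-inverseʳ (ψ (rest x))))
        (trans (cong (indicator (h p x) [] *_) (*-zeroʳ (χ x))) (*-zeroʳ (indicator (h p x) [])))
      branch s short ρ@(v ∷ vs) = DegLt-cong (λ x → swap (χ x) (indicator (h p x) ρ) (ψ (ρ ++ rest x) - ψ (rest x))) (χ′-branch s short)
        where
        swap : ∀ a b c → (a * b) * c ≡ b * (a * c)
        swap = solve-∀
        χ′ : Cube N → ℤ
        χ′ x = χ x * indicator (h p x) ρ
        χ′-deg : Deg (c ℕ.+ e) χ′
        χ′-deg = Deg-* χ-deg (h-deg p (λ r → indicator r ρ))
        ψ′ : List Val → ℤ
        ψ′ l = ψ (ρ ++ l) - ψ l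
        matched : ∀ x → χ′ x ≢ 0ℤ → χ x ≢ 0ℤ × h p x ≡ ρ
        matched x χ′≢0 = (λ χ≡0 → χ′≢0 (cong (_* indicator (h p x) ρ) χ≡0)) ,
          indicator-nonzero (λ i≡0 → χ′≢0 (trans (cong (χ x *_) i≡0) (*-zeroʳ (χ x))))
        remaining : ∀ {s} → (∀ x → χ x ≢ 0ℤ → length (h p x ++ rest x) ≤ s) → ∀ x → χ′ x ≢ 0ℤ → suc (length (rest x)) ≤ s
        remaining {s} short x χ′≢0 with matched x χ′≢0
        ... | χ≢0 , hx≡ρ = ℕₚ.≤-trans (s≤s (ℕₚ.≤-trans (ℕₚ.m≤n+m _ (length vs)) (ℕₚ.≤-reflexive (sym (length-++ vs)))))
          (subst (λ l → length (l ++ rest x) ≤ s) hx≡ρ (short x χ≢0))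
        χ′-branch : ∀ s → (∀ x → χ x ≢ 0ℤ → length (h p x ++ rest x) ≤ s) → Deg (c ℕ.+ s ℕ.* e) (λ x → χ′ x * ψ′ (rest x))
        -- With no room left, a nonempty write contradicts the capacity, so `χ′` is identically
        -- zero.
        χ′-branch zero short = vanishes λ x → cong (_* ψ′ (rest x)) (χ′-zero x)
          where
          χ′-zero : ∀ x → χ′ x ≡ 0ℤ
          χ′-zero x with χ′ x ℤ.≟ 0ℤ
          ... | yes ≡0 = ≡0
          ... | no  ≢0 = contradiction (remaining short x ≢0) λ ()
        -- The new indicator adds `e` to the degree of `χ` and uses up at least one of the `suc s`
        -- places.
        χ′-branch (suc s) short = DegLt-≡ (cong suc (ℕₚ.+-assoc c e (s ℕ.* e)))
          (concatMap-Deg h h-deg ps s χ′ χ′-deg (λ x ≢0 → ℕₚ.≤-pred (remaining short x ≢0)) ψ′)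

    concatMap-FunDeg : ∀ {P : Set} {e} (h : P → Cube N → List Val) → (∀ p → FunDeg e (h p)) →
      ∀ ps s → (∀ x → length (concatMap (λ p → h p x) ps) ≤ s) → FunDeg (s ℕ.* e) (λ x → concatMap (λ p → h p x) ps)
    concatMap-FunDeg h h-deg ps s short ψ = DegLt-cong (λ x → *-identityˡ _)
      (concatMap-Deg h h-deg ps s (λ _ → 1ℤ) (DegLt-const 1ℤ) (λ x _ → short x) ψ)

    valuesAt-++ : ∀ k D D′ → valuesAt k (D ++ D′) ≡ valuesAt k D ++ valuesAt k D′
    valuesAt-++ k D D′ = trans (cong (map proj₂) (filter-++ at-k D D′)) (map-++ proj₂ (filter at-k D) (filter at-k D′))
      where
      at-k : (kv : Key × Val) → Dec (proj₁ kv ≡ k)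
      at-k kv = proj₁ kv ≟K k

    valuesAt-concatMap : ∀ {P : Set} k (f : P → Store) ps →
      concatMap (λ p → valuesAt k (f p)) ps ≡ valuesAt k (concatMap f ps)
    valuesAt-concatMap k f []       = refl
    valuesAt-concatMap k f (p ∷ ps) = trans (cong (valuesAt k (f p) ++_) (valuesAt-concatMap k f ps))
      (sym (valuesAt-++ k (f p) (concatMap f ps)))

    response-concatMap-Deg : ∀ {P : Set} {e} k (f : P → Cube N → Store) →
      (∀ p → FunDeg e (λ x → valuesAt k (f p x))) → ∀ ps s →
      (∀ x → length (valuesAt k (concatMap (λ p → f p x) ps)) ≤ s) →
      FunDeg (s ℕ.* e) (λ x → response k (concatMap (λ p → f p x) ps))
    response-concatMap-Deg k f f-deg ps s short φ =
      DegLt-cong (λ x → cong (φ ∘ sortℕ) (valuesAt-concatMap k (λ p → f p x) ps))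
        (concatMap-FunDeg (λ p x → valuesAt k (f p x)) f-deg ps s
          (λ x → subst (λ l → length l ≤ s) (sym (valuesAt-concatMap k (λ p → f p x) ps)) (short x)) (φ ∘ sortℕ))

    step-Deg : ∀ {d} S (D : Cube N → Store) ms → (∀ k → FunDeg d (λ x → response k (D x))) →
      (∀ x k → length (valuesAt k (step S (D x) ms)) ≤ S) →
      ∀ k → FunDeg (S ℕ.* (S ℕ.* d)) (λ x → response k (step S (D x) ms))
    step-Deg S D ms D-deg short k = response-concatMap-Deg k (λ p x → writesOf (run S (D x) p))
      (λ p φ → run-Deg D D-deg p S (φ ∘ valuesAt k ∘ writesOf)) ms S (λ x → short x k)

    inputPair : (Fin N → Bool) → Fin N → Key × Val
    inputPair x i = inp (toℕ i) , bitVal (x i)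

    map-concatMap : ∀ (x : Fin N → Bool) L → concatMap (λ i → [ inputPair x i ]) L ≡ map (inputPair x) L
    map-concatMap x []      = refl
    map-concatMap x (i ∷ L) = cong (inputPair x i ∷_) (map-concatMap x L)

    input-capacity : ∀ k (x : Fin N → Bool) L → Unique L → length (valuesAt k (map (inputPair x) L)) ≤ 1
    input-capacity k x []      _          = z≤n
    input-capacity k x (i ∷ L) (i∉ ∷ uniq) with inp (toℕ i) ≟K k
    ... | no  _    = input-capacity k x L uniq
    ... | yes refl = s≤s (ℕₚ.≤-reflexive (cong (length ∘ map proj₂)
      (filter-none (λ kv → proj₁ kv ≟K k) (Allₚ.map⁺ (All.map (λ i≢j eq → i≢j (Finₚ.toℕ-injective (inp-injective (sym eq)))) i∉)))))
      where
      inp-injective : ∀ {m n} → inp m ≡ inp n → m ≡ n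
      inp-injective refl = refl

    -- The input acts as the output of `N` machines, each depending on one coordinate, with at most
    -- one value per key.
    input-Deg : ∀ k → FunDeg 1 (λ x → response k (inputStore (lookup x)))
    input-Deg k φ = DegLt-cong (λ x → cong (φ ∘ response k) (map-concatMap (lookup x) (allFin N)))
      (response-concatMap-Deg k (λ i x → [ inputPair (lookup x) i ])
        (λ i φ → Deg-coordinate (λ b → φ (valuesAt k [ (inp (toℕ i) , bitVal b) ])) i) (allFin N) 1
        (λ x → subst (λ D → length (valuesAt k D) ≤ 1) (sym (map-concatMap (lookup x) (allFin N)))
          (input-capacity k (lookup x) (allFin N) (allFin⁺ N))) φ)

    votes : Store → ℕ
    votes D = length (filter (ℕₚ._≟ 1) (valuesAt answer D))

    votes-++ : ∀ D D′ → votes (D ++ D′) ≡ votes D ℕ.+ votes D′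
    votes-++ D D′ = trans (cong length (trans (cong (filter (ℕₚ._≟ 1)) (valuesAt-++ answer D D′))
      (filter-++ (ℕₚ._≟ 1) (valuesAt answer D) (valuesAt answer D′)))) (length-++ (filter (ℕₚ._≟ 1) (valuesAt answer D)))

    -- Votes add up over the machines, so only the degree of a single run enters.
    votes-step-Deg : ∀ {d} S (D : Cube N → Store) → (∀ k → FunDeg d (λ x → response k (D x))) →
      ∀ ms → Deg (S ℕ.* d) (λ x → + votes (step S (D x) ms))
    votes-step-Deg S D D-deg []       = DegLt-const 0ℤ
    votes-step-Deg S D D-deg (p ∷ ms) = DegLt-cong
      (λ x → sym (trans (cong +_ (votes-++ (writesOf (run S (D x) p)) (step S (D x) ms)))
                        (pos-+ (votes (writesOf (run S (D x) p))) (votes (step S (D x) ms)))))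
      (DegLt-+ (run-Deg D D-deg p S (λ w → + votes (writesOf w))) (votes-step-Deg S D D-deg ms))

    votes-Deg : ∀ {d} S R (A : Algorithm (suc R)) (D : Cube N → Store) → (∀ k → FunDeg d (λ x → response k (D x))) →
      (∀ x (r : Fin (suc R)) k → length (valuesAt k (lookup (trace S A (D x)) (suc r))) ≤ S) →
      Deg (S ℕ.* ((S ℕ.* S) ℕ.^ R ℕ.* d)) (λ x → + votes (lookup (trace S A (D x)) (fromℕ (suc R))))
    votes-Deg {d} S zero    (ms ∷ [])      D D-deg short =
      DegLt-≡ (cong (λ n → suc (S ℕ.* n)) (sym (ℕₚ.*-identityˡ d))) (votes-step-Deg S D D-deg ms)
    votes-Deg {d} S (suc R) (ms ∷ ms′ ∷ A) D D-deg short =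
      DegLt-≡ (cong suc (regroup S ((S ℕ.* S) ℕ.^ R) d))
        (votes-Deg S R (ms′ ∷ A) (λ x → step S (D x) ms) (step-Deg S D ms D-deg (λ x k → short x zero k))
          (λ x r k → short x (suc r) k))
      where
      regroup : ∀ S T d → S ℕ.* (T ℕ.* (S ℕ.* (S ℕ.* d))) ≡ S ℕ.* (S ℕ.* S ℕ.* T ℕ.* d)
      regroup = ℕ-Solver.solve-∀

-- Combining the bounds.

module Assembly where

  open BooleanCube
  open ChainLength
  open AMPC
  open import Data.Nat using (ℕ; zero; suc; _+_; _*_; _^_; _≤_; z≤n; s≤s; NonZero)
  open import Data.Nat.Properties
  open import Data.Nat.Tactic.RingSolver using (solve-∀)
  open import Data.Bool using (Bool; true; false)
  open import Data.Fin using (Fin; suc; fromℕ)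
  open import Data.Integer as ℤ using (ℤ; +_; +≤+)
  open import Data.List using (_∷_; []; length; allFin)
  open import Data.List.Properties using (length-filter; map-cong)
  open import Data.Maybe using (just)
  open import Data.Product using (_,_)
  open import Data.Vec using ([]; tabulate; lookup)
  open import Data.Vec.Properties using (lookup∘tabulate)
  open import Relation.Binary.PropositionalEquality
  open import Relation.Nullary using (¬_; does; contradiction)

  isOne : ℤ → Bool
  isOne z = does (z ℤ.≟ ℤ.1ℤ)

  D≤-never-defined : ∀ {N d} {g : Partial N} → (∀ x b → ¬ g x ≡ just b) → D≤ g d
  D≤-never-defined undefined =
    (λ _ → false) , (λ x b gx≡b → contradiction gx≡b (undefined x b)) , leaf false , z≤n , λ _ → refl

  cube-of-power : ∀ S R → (S * S) ^ R * (S * S) ^ R * (S * S) ^ R ≡ S ^ (6 * R)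
  cube-of-power S R = trans (go R) (^-*-assoc S 6 R)
    where
    next : ∀ S T → (S * S * T) * (S * S * T) * (S * S * T) ≡ S * (S * (S * (S * (S * (S * 1))))) * (T * T * T)
    next = solve-∀
    go : ∀ R → (S * S) ^ R * (S * S) ^ R * (S * S) ^ R ≡ (S ^ 6) ^ R
    go zero    = refl
    go (suc R) = trans (next S ((S * S) ^ R)) (cong (S ^ 6 *_) (go R))

  -- With `T = (S * S) ^ R` the left side is `8 S⁴ T³`; using `4 ≤ S²` it is at most `2 S⁶ T³`.
  depth-bound : ∀ S R → 2 ≤ S → let e = S * ((S * S) ^ R * 1) in
    (4 * (e * e * S) + 4 * (e * e * S)) * e ≤ 2 * S ^ (6 * suc R)
  depth-bound S R 2≤S = begin
    (4 * (e * e * S) + 4 * (e * e * S)) * e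
      ≡⟨ expand S ((S * S) ^ R) ⟩
    2 * ((2 * 2) * (S * S * S * S * (T * T * T)))
      ≤⟨ *-monoʳ-≤ 2 (*-monoˡ-≤ (S * S * S * S * (T * T * T)) (*-mono-≤ 2≤S 2≤S)) ⟩
    2 * ((S * S) * (S * S * S * S * (T * T * T)))
      ≡⟨ collect S T ⟩
    2 * (S ^ 6 * (T * T * T))
      ≡⟨ cong (λ u → 2 * (S ^ 6 * u)) (cube-of-power S R) ⟩
    2 * (S ^ 6 * S ^ (6 * R))
      ≡⟨ cong (2 *_) (sym (^-distribˡ-+-* S 6 (6 * R))) ⟩
    2 * S ^ (6 + 6 * R)
      ≡⟨ cong (λ n → 2 * S ^ n) (sym (*-suc 6 R)) ⟩
    2 * S ^ (6 * suc R) ∎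
    where
    open ≤-Reasoning
    T e : ℕ
    T = (S * S) ^ R
    e = S * (T * 1)
    expand : ∀ S T → (4 * (S * (T * 1) * (S * (T * 1)) * S) + 4 * (S * (T * 1) * (S * (T * 1)) * S)) * (S * (T * 1))
      ≡ 2 * ((2 * 2) * (S * S * S * S * (T * T * T)))
    expand = solve-∀
    collect : ∀ S T → 2 * ((S * S) * (S * S * S * S * (T * T * T))) ≡ 2 * (S * (S * (S * (S * (S * (S * 1))))) * (T * T * T))
    collect = solve-∀

  module _ {N R : ℕ} (S : ℕ) (g : Partial N) (A : Algorithm (suc R)) (comp : Computes S A g) where

    open Computes comp

    finalVotes : Cube N → ℤ
    finalVotes x = + votes {N} (storeAt S A (lookup x) (fromℕ (suc R)))

    finalVotes-Deg : Deg (S * ((S * S) ^ R * 1)) finalVotes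
    finalVotes-Deg = votes-Deg S R A (λ x → inputStore (lookup x)) input-Deg (λ x → key-capacity (lookup x))

    finalVotes-nonneg : ∀ x → ℤ.0ℤ ℤ.≤ finalVotes x
    finalVotes-nonneg x = +≤+ z≤n

    -- Key capacity holds on every input, so the bound is also available outside the domain of `g`,
    -- where the random assignments may land.
    finalVotes-≤ : ∀ x → finalVotes x ℤ.≤ + S
    finalVotes-≤ x = +≤+ (≤-trans (length-filter (_≟ 1) (valuesAt answer (storeAt S A (lookup x) (fromℕ (suc R)))))
      (key-capacity (lookup x) (fromℕ R) answer))

    finalVotes-correct : ∀ x b → g x ≡ just b → isOne (finalVotes (tabulate x)) ≡ b
    finalVotes-correct x b gx≡b = trans (cong (λ D → isOne (+ votes {N} D)) store) (decode b)
      where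
      store : storeAt S A (lookup (tabulate x)) (fromℕ (suc R)) ≡ (answer , bitVal b) ∷ []
      -- `lookup (tabulate x)` and `x` agree only pointwise, but they induce equal input lists.
      store = trans (cong (λ D → lookup (trace S A D) (fromℕ (suc R)))
          (map-cong (λ i → cong (λ v → inp _ , bitVal v) (lookup∘tabulate x i)) (allFin N)))
        (correct x b gx≡b)
      decode : ∀ b → isOne (+ votes {N} ((answer , bitVal b) ∷ [])) ≡ b
      decode false = refl
      decode true  = refl

    tree⇒D≤ : ∀ {d} → Trees.TreeFor isOne finalVotes d → D≤ g d
    tree⇒D≤ (T , T≤d , ok) =
      evalDT T , (λ x b gx≡b → trans (ok x) (finalVotes-correct x b gx≡b)) , T , T≤d , λ _ → refl

    -- Up-jumps and down-jumps contribute at most `K` rounds each, and a round queries at most `e`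
    -- variables.
    D≤-by-jumps : ∀ {e K} → Deg e finalVotes →
      (∀ Bs x → ℤ.∣ totalJump Bs finalVotes x ∣ ≤ K) → D≤ g ((K + K) * e)
    D≤-by-jumps {e} {K} deg bound = tree⇒D≤ (Trees.tree isOne (K + K) e finalVotes deg
      λ c → 1+n≰n (chain-length bound (tabulate λ _ → false) c))

    undefined-without-capacity : S ≡ 0 → ∀ x b → ¬ g x ≡ just b
    undefined-without-capacity refl x b gx≡b
      with subst (λ D → length (valuesAt answer D) ≤ 0) (correct x b gx≡b) (key-capacity x (fromℕ R) answer)
    ... | ()

  D≤-weaken : ∀ {N d d′} {g : Partial N} → d ≤ d′ → D≤ g d → D≤ g d′
  D≤-weaken d≤d′ (f , agree , T , T≤d , ok) = f , agree , T , ≤-trans T≤d d≤d′ , ok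

  query-bound : ∀ N S R (g : Partial N) (A : Algorithm R) → Computes S A g → D≤ g (2 * S ^ (6 * R))
  -- Without rounds the final store is the input, which never consists of an `answer` pair; so `g`
  -- is nowhere defined.
  query-bound N S zero g [] comp = D≤-never-defined {g = g} λ x b gx≡b → impossible N x (Computes.correct comp x b gx≡b)
    where
    impossible : ∀ N (x : Fin N → Bool) {v} → ¬ inputStore x ≡ (answer , v) ∷ []
    impossible zero    x ()
    impossible (suc N) x ()
  query-bound N 0 (suc R) g A comp = D≤-never-defined {g = g} (undefined-without-capacity 0 g A comp refl)
  -- Here degree and jump bound are both 1, so depth `(1 + 1) * 1` meets the target 2 exactly.
  query-bound N 1 (suc R) g A comp = subst (D≤ g) (cong (2 *_) (sym (^-zeroˡ (6 * suc R))))
    (D≤-by-jumps 1 g A comp deg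
      λ Bs x → totalJump-bound-linear 1 (finalVotes-nonneg 1 g A comp) (finalVotes-≤ 1 g A comp) Bs x deg)
    where
    deg : Deg 1 (finalVotes 1 g A comp)
    deg = DegLt-≡ (cong (λ n → suc (1 * (n * 1))) (^-zeroˡ R)) (finalVotes-Deg 1 g A comp)
  query-bound N S@(suc (suc s)) (suc R) g A comp = D≤-weaken {g = g} (depth-bound S R (s≤s (s≤s z≤n)))
    (D≤-by-jumps S g A comp deg jumps)
    where
    e : ℕ
    e = S * ((S * S) ^ R * 1)
    deg : Deg e (finalVotes S g A comp)
    deg = finalVotes-Deg S g A comp
    e-nonzero : NonZero e
    e-nonzero = m*n≢0 S ((S * S) ^ R * 1) {{_}} {{m*n≢0 ((S * S) ^ R) 1 {{m^n≢0 (S * S) R}}}}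
    jumps : ∀ Bs x → ℤ.∣ totalJump Bs (finalVotes S g A comp) x ∣ ≤ 4 * (e * e * S)
    -- `totalJump-bound` expects a successor as degree; `go` generalises over `e` to expose one.
    jumps Bs x = go e e-nonzero deg
      where
      go : ∀ e → NonZero e → Deg e (finalVotes S g A comp) → ℤ.∣ totalJump Bs (finalVotes S g A comp) x ∣ ≤ 4 * (e * e * S)
      go (suc e) _ deg = totalJump-bound S (finalVotes-nonneg S g A comp) (finalVotes-≤ S g A comp) e Bs x deg

open import Data.Nat using (ℕ; _*_; _^_)

theorem4p4 : (N S R : ℕ) (g : Partial N) (A : Algorithm R) →
    Computes S A g → D≤ g (2 * S ^ (6 * R))
theorem4p4 = Assembly.query-bound
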